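{- The problem $\mathrm{BSR}$ cannot be solved in time $2^{o(\mathtt{t}\cdot\log(\mathtt{P}))}$ unless the Exponential Time Hypothesis (ETH) fails.
   Context: ETH asserts that there is no algorithm solving $n$-variable 3-SAT in time $2^{o(n)}$. Programs. A (shared memory) program is a tuple $\mathcal{A}=(D,a^0,(P_i)_{i\in[1..\mathtt{t}]})$ with a finite data domain $D$, an initial memory value $a^0\in D$, and threads $P_i$. Let $\mathrm{Op}(D)=\{!a,?a \mid a\in D\}$ ($!a$ writes $a$ to the memory, $?a$ reads $a$ from it). Each thread is a nondeterministic finite automaton $P_i=(\mathrm{Op}(D),Q_i,q_i^0,\delta_i)$ with finite state set $Q_i$, initial state $q_i^0$ and transition relation $\delta_i\subseteq Q_i\times(\mathrm{Op}(D)\cup\{\varepsilon\})\times Q_i$. A configuration is a pair $(\mathit{pc},a)$ with $\mathit{pc}\in Q_1\times\dots\times Q_{\mathtt{t}}$ and $a\in D$; $C$ is the set of all configurations and the initial configuration is $c^0=((q_1^0,\dots,q_{\mathtt{t}}^0),a^0)$. A step lets one thread $P_i$ take a transition from its current state $q$ to $q'$ (the other threads keep their states): a transition $(q,?a,q')$ is possible only if the memory holds $a$, and leaves the memory unchanged; a transition $(q,!b,q')$ is possible for any memory value and sets the memory to $b$; a transition $(q,\varepsilon,q')$ leaves the memory unchanged. A computation is a finite sequence of consecutive steps, written $c\rightarrow^*_{\mathcal{A}}c'$. Stages. A stage is a computation in which only one of the threads writes; the remaining threads are restricted to reading the memory (and $\varepsilon$-transitions). An $\mathtt{s}$-stage computation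 is a computation that can be split into $\mathtt{s}$ parts, each of which forms a stage. Bounded-Stage Reachability ($\mathrm{BSR}$). Input: a program $\mathcal{A}=(D,a^0,(P_i)_{i\in[1..\mathtt{t}]})$, a set $C^f\subseteq C$, and $\mathtt{s}\in\mathbb{N}$. Question: is there an $\mathtt{s}$-stage computation $c^0\rightarrow^*_{\mathcal{A}}c$ for some $c\in C^f$? Parameters: $\mathtt{P}=\max_i|Q_i|$ is the maximum number of states of a thread, $\mathtt{t}$ is the number of threads. -}

module Defs where

open import Data.Bool.Base using (Bool; true; false)
open import Data.Fin.Base using (Fin; zero; toℕ)
open import Data.List.Base using (List; []; _∷_; map; tabulate)
open import Data.List.Membership.Propositional using (_∈_)
open import Data.List.Relation.Unary.All using (All)
open import Data.List.Relation.Unary.Any using (Any)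
open import Data.Maybe.Base using (Maybe; just; nothing)
open import Data.Nat.Base using (ℕ; zero; suc; _+_; _*_; _^_; _≤_; _⊔_; NonZero)
open import Data.Nat.Binary.Base using (ℕᵇ; zero; 2[1+_]; 1+[2_]; fromℕ)
open import Data.Product.Base using (_×_; _,_; ∃-syntax; Σ-syntax)
open import Data.Vec.Base as Vec using (Vec; lookup; _[_]≔_; replicate)
open import Data.Vec.Functional using (Vector; foldr)
open import Data.Vec.Relation.Unary.Any using () renaming (Any to Anyᵛ)
open import Function.Bundles using (_⇔_)
open import Relation.Binary.Construct.Closure.ReflexiveTransitive using (Star)
open import Relation.Binary.PropositionalEquality using (_≡_; _≢_)
open import Relation.Nullary using (¬_)

-- The machine model is the language WHILE of N. D. Jones
-- ("Computability and Complexity from a Programming Perspective"):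
-- imperative programs over binary trees with finitely many variables.
-- It simulates, and is simulated by, multi-tape Turing machines with
-- polynomial overhead in time, so the time classes defined below do not
-- depend on the choice between the two.

infixr 5 _∙_

data Tree : Set where
  nil : Tree
  _∙_ : Tree → Tree → Tree

size : Tree → ℕ
size nil     = 1
size (l ∙ r) = 1 + size l + size r

data Expr (k : ℕ) : Set where
  var   : Fin k → Expr k
  nil   : Expr k
  cons  : Expr k → Expr k → Expr k
  hd tl : Expr k → Expr k

infixr 4 _⨾_
infix  5 _≔_

data Cmd (k : ℕ) : Set where
  skip          : Cmd k
  _≔_           : Fin k → Expr k → Cmd k
  _⨾_           : Cmd k → Cmd k → Cmd k
  if_then_else_ : Expr k → Cmd k → Cmd k → Cmd k
  while_loop_     : Expr k → Cmd k → Cmd k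

Store : ℕ → Set
Store k = Vec Tree k

hdᵗ tlᵗ : Tree → Tree
hdᵗ nil     = nil
hdᵗ (l ∙ r) = l
tlᵗ nil     = nil
tlᵗ (l ∙ r) = r

eval : ∀ {k} → Expr k → Store k → Tree
eval (var x)    σ = lookup σ x
eval nil        σ = nil
eval (cons e f) σ = eval e σ ∙ eval f σ
eval (hd e)     σ = hdᵗ (eval e σ)
eval (tl e)     σ = tlᵗ (eval e σ)

cost : ∀ {k} → Expr k → ℕ
cost (var x)    = 1
cost nil        = 1
cost (cons e f) = 1 + cost e + cost f
cost (hd e)     = 1 + cost e
cost (tl e)     = 1 + cost e

-- ⟨ C , σ ⟩⇓[ τ ] σ′ : started in σ, the command C halts in σ′ after time τ.
-- As a truth value, nil is false and every other tree is true.

data ⟨_,_⟩⇓[_]_ {k : ℕ} : Cmd k → Store k → ℕ → Store k → Set where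
  skip : ∀ {σ} → ⟨ skip , σ ⟩⇓[ 1 ] σ
  assign : ∀ {σ x e} →
    ⟨ x ≔ e , σ ⟩⇓[ 1 + cost e ] (σ [ x ]≔ eval e σ)
  seq : ∀ {σ σ′ σ″ C D τ τ′} →
    ⟨ C , σ ⟩⇓[ τ ] σ′ → ⟨ D , σ′ ⟩⇓[ τ′ ] σ″ →
    ⟨ C ⨾ D , σ ⟩⇓[ τ + τ′ ] σ″
  if-true : ∀ {σ σ′ e C D τ} → eval e σ ≢ nil → ⟨ C , σ ⟩⇓[ τ ] σ′ →
    ⟨ if e then C else D , σ ⟩⇓[ 1 + cost e + τ ] σ′
  if-false : ∀ {σ σ′ e C D τ} → eval e σ ≡ nil → ⟨ D , σ ⟩⇓[ τ ] σ′ →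
    ⟨ if e then C else D , σ ⟩⇓[ 1 + cost e + τ ] σ′
  while-true : ∀ {σ σ′ σ″ e C τ τ′} → eval e σ ≢ nil →
    ⟨ C , σ ⟩⇓[ τ ] σ′ → ⟨ while e loop C , σ′ ⟩⇓[ τ′ ] σ″ →
    ⟨ while e loop C , σ ⟩⇓[ 1 + cost e + τ + τ′ ] σ″
  while-false : ∀ {σ e C} → eval e σ ≡ nil →
    ⟨ while e loop C , σ ⟩⇓[ 1 + cost e ] σ

-- The input is placed in variable 0, all other variables start as nil, and
-- the answer is read off variable 0.

record Algorithm : Set where
  field
    aux  : ℕ
    body : Cmd (suc aux)

record Problem : Set₁ where
  field
    Instance : Set
    encode   : Instance → Tree
    Yes      : Instance → Set

record DecidesIn (𝒫 : Problem) (A : Algorithm)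
                 (bound : Problem.Instance 𝒫 → ℕ) : Set where
  open Problem 𝒫
  open Algorithm A
  field
    decides : ∀ x → ∃[ τ ] ∃[ out ] ∃[ σ ]
      ⟨ body , encode x Vec.∷ replicate aux nil ⟩⇓[ τ ] (out Vec.∷ σ)
      × (out ≢ nil ⇔ Yes x)
      × τ ≤ bound x

LittleO : (ℕ → ℕ) → Set
LittleO f = ∀ c → ∃[ N ] (∀ n → N ≤ n → c * f n ≤ n)

-- "𝒫 can be solved in time 2^o(κ)".  As usual for running times measured in a
-- parameter κ, factors polynomial in the length of the input are disregarded:
-- κ need not bound that length, so without such a factor the time might not
-- even suffice for reading the input.

SolvableInTime2^o : (𝒫 : Problem) → (Problem.Instance 𝒫 → ℕ) → Set
SolvableInTime2^o 𝒫 κ =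
  ∃[ A ] ∃[ f ] ∃[ c ]
    LittleO f
    × DecidesIn 𝒫 A (λ x → 2 ^ f (κ x) * size (encode x) ^ c)
  where open Problem 𝒫

-- Finite sets are given by listing their elements, so their
-- cardinalities and elements are encoded in unary; proper numeric inputs are
-- encoded in binary.

enc-unary : ℕ → Tree
enc-unary zero    = nil
enc-unary (suc n) = nil ∙ enc-unary n

enc-ℕᵇ : ℕᵇ → Tree
enc-ℕᵇ zero     = nil
enc-ℕᵇ 2[1+ b ] = nil ∙ enc-ℕᵇ b
enc-ℕᵇ 1+[2 b ] = (nil ∙ nil) ∙ enc-ℕᵇ b

enc-binary : ℕ → Tree
enc-binary n = enc-ℕᵇ (fromℕ n)

enc-Fin : ∀ {n} → Fin n → Tree
enc-Fin i = enc-unary (toℕ i)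

enc-Bool : Bool → Tree
enc-Bool false = nil
enc-Bool true  = nil ∙ nil

enc-trees : List Tree → Tree
enc-trees []       = nil
enc-trees (t ∷ ts) = t ∙ enc-trees ts

enc-List : ∀ {A : Set} → (A → Tree) → List A → Tree
enc-List enc xs = enc-trees (map enc xs)

-- (x , true) is the literal x and (x , false) its negation.  Literals may be
-- repeated in a clause, which caters for clauses with fewer than three.

Literal Clause : ℕ → Set
Literal n = Fin n × Bool
Clause n  = Vec (Literal n) 3

record 3-CNF : Set where
  field
    variables : ℕ
    clauses   : List (Clause variables)

Satisfiable : 3-CNF → Set
Satisfiable φ =
  Σ[ α ∈ (Fin variables → Bool) ] All (Anyᵛ (λ (x , b) → α x ≡ b)) clauses
  where open 3-CNF φ

enc-3-CNF : 3-CNF → Tree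
enc-3-CNF φ = enc-unary variables ∙ enc-List enc-clause clauses
  where
  open 3-CNF φ
  enc-literal : Literal variables → Tree
  enc-literal (x , b) = enc-Fin x ∙ enc-Bool b
  enc-clause : Clause variables → Tree
  enc-clause C = enc-List enc-literal (Vec.toList C)

3-SAT : Problem
3-SAT = record { Instance = 3-CNF ; encode = enc-3-CNF ; Yes = Satisfiable }

ETH : Set
ETH = ¬ SolvableInTime2^o 3-SAT 3-CNF.variables

data Op (D : Set) : Set where
  write read : D → Op D

Label : Set → Set
Label D = Maybe (Op D)

pattern ε = nothing

record Thread (D : Set) : Set where
  field
    states : ℕ
    q⁰     : Fin states
    δ      : List (Fin states × Label D × Fin states)

record Program : Set where
  field
    domain         : ℕ
    a⁰             : Fin domain
    t              : ℕ
    .{{t-nonZero}} : NonZero t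
    threads        : Vector (Thread (Fin domain)) t

  D : Set
  D = Fin domain

  open module P (i : Fin t) = Thread (threads i) public

maxStates : Program → ℕ
maxStates 𝒜 = foldr _⊔_ 0 (Program.states 𝒜)

module Semantics (𝒜 : Program) where
  open Program 𝒜

  record Config : Set where
    constructor _,_
    field
      pc  : ∀ i → Fin (states i)
      mem : D

  open Config public

  -- Equality of configurations; pc is a function and compared pointwise.
  _≈_ : Config → Config → Set
  c ≈ c′ = (∀ i → pc c i ≡ pc c′ i) × mem c ≡ mem c′

  c⁰ : Config
  c⁰ = q⁰ , a⁰

  data Memory : Label D → D → D → Set where
    silent : ∀ {a}   → Memory ε a a
    read   : ∀ {a}   → Memory (just (read a)) a a
    write  : ∀ {a b} → Memory (just (write b)) a b

  record Step (i : Fin t) (ℓ : Label D) (c c′ : Config) : Set where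
    field
      transition : (pc c i , ℓ , pc c′ i) ∈ δ i
      memory     : Memory ℓ (mem c) (mem c′)
      others     : ∀ j → j ≢ i → pc c′ j ≡ pc c j

  StageStep : Fin t → Config → Config → Set
  StageStep w c c′ =
    ∃[ i ] ∃[ ℓ ] Step i ℓ c c′ × (∀ b → ℓ ≡ just (write b) → i ≡ w)

  Stage : Config → Config → Set
  Stage c c′ = ∃[ w ] Star (StageStep w) c c′

  -- A part of the splitting may be the empty computation, as computations
  -- may be empty and a stage need not contain a write.
  data StagedComputation : ℕ → Config → Config → Set where
    []  : ∀ {c} → StagedComputation 0 c c
    _∷_ : ∀ {s c c′ c″} → Stage c c′ → StagedComputation s c′ c″ →
          StagedComputation (suc s) c c″

record BSR-Instance : Set where
  field
    𝒜 : Program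
  open Program 𝒜 public
  open Semantics 𝒜 public
  field
    Cᶠ : List Config
    s  : ℕ

BSR-Yes : BSR-Instance → Set
BSR-Yes I = ∃[ c ] Any (c ≈_) Cᶠ × StagedComputation s c⁰ c
  where open BSR-Instance I

enc-Label : ∀ {n} → Label (Fin n) → Tree
enc-Label ε            = nil
enc-Label (just (read a)) = nil ∙ enc-Fin a
enc-Label (just (write a)) = (nil ∙ nil) ∙ enc-Fin a

enc-Thread : ∀ {n} → Thread (Fin n) → Tree
enc-Thread P =
  enc-unary states ∙ enc-Fin q⁰
    ∙ enc-List (λ (q , ℓ , q′) → enc-Fin q ∙ enc-Label ℓ ∙ enc-Fin q′) δ
  where open Thread P

enc-Program : Program → Tree
enc-Program 𝒜 =
  enc-unary domain ∙ enc-Fin a⁰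
    ∙ enc-trees (tabulate (λ i → enc-Thread (threads i)))
  where open Program 𝒜

enc-BSR : BSR-Instance → Tree
enc-BSR I = enc-Program 𝒜 ∙ enc-List enc-Config Cᶠ ∙ enc-binary s
  where
  open BSR-Instance I
  enc-Config : Config → Tree
  enc-Config c = enc-trees (tabulate (λ i → enc-Fin (pc c i))) ∙ enc-Fin (mem c)

BSR : Problem
BSR = record { Instance = BSR-Instance ; encode = enc-BSR ; Yes = BSR-Yes }

-- With P = maxThreadStates, t · ⌈log₂ P ⌉ and t · log P differ by at most a
-- factor of 2, so o(_) of either is the same.
numThreads maxThreadStates : BSR-Instance → ℕ
numThreads I      = BSR-Instance.t I
maxThreadStates I = maxStates (BSR-Instance.𝒜 I)

{-# OPTIONS --safe #-}

-- The proof is a direct reduction that turns a 3-CNF with n variables into a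
-- program with n + 1 threads of 37 states each, so that t · log P = O(n).
-- Only the memory domain grows with the number of clauses, hence no
-- sparsification is needed, and the stage bound is so large that it is no
-- restriction.
--
-- Thread x guesses the value of variable x and always knows whether x and ¬x
-- occur in the clause under inspection.  Jointly the threads thus know this
-- clause as a set of literals, i.e. its position in the list of all clauses,
-- once duplicates are removed.  A token carried by the memory visits all
-- threads and records whether one of them satisfies the clause.  Upon its
-- return the controller writes the number of any clause.  A thread can follow
-- from its i-th to its (j + 1)-st clause only if it cannot tell clauses i and
-- j apart, so for a wrong number some thread stays behind, where the next
-- token gets stuck.
--
-- The instance is computed by a term of a small language of tree functions
-- all of whose programs run in polynomial time.

module Submission where

open import Defs
open import Data.Bool.Base using (Bool; true; false; _∨_; _∧_; not) renaming (if_then_else_ to ifᵇ_then_else_)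
open import Data.Bool.Properties using (T-≡; T-∧; ∨-zeroʳ; ∨-identityʳ; ∨-assoc)
open import Data.Empty using (⊥-elim)
open import Data.Fin.Base using (Fin; zero; suc; toℕ; fromℕ; inject₁; combine; _↑ˡ_; _↑ʳ_; splitAt)
open import Data.Fin.Induction using (<-weakInduction)
open import Data.Fin.Patterns
open import Data.Fin.Properties using (toℕ-injective; toℕ-inject₁; toℕ-fromℕ; toℕ<n; toℕ-↑ˡ; toℕ-↑ʳ; combine-injective; splitAt-↑ˡ; splitAt-↑ʳ; suc-injective; inject₁-injective; fromℕ≢inject₁; ↑ʳ-injective; _≟_)
open import Data.List.Base using (List; []; _∷_; _++_; length; lookup; map; concat; concatMap; tabulate; replicate; foldr; cartesianProduct)
open import Data.List.Membership.Propositional using (_∈_; find; lose)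
open import Data.List.Membership.Propositional.Properties using (∈-map⁺; ∈-map⁻; ∈-++⁺ˡ; ∈-++⁺ʳ; ∈-++⁻; ∈-concat⁺′; ∈-concat⁻′; ∈-concatMap⁺; ∈-concatMap⁻; ∈-tabulate⁺; ∈-tabulate⁻; ∈-cartesianProduct⁺; ∈-lookup)
open import Data.List.Properties using (++-assoc; ++-identityʳ; map-++; map-∘; map-cong; map-tabulate; concat-map; concat-++; concat-map-[_]; length-map; length-replicate)
open import Data.List.Relation.Unary.All as All using (All; []; _∷_)
open import Data.List.Relation.Unary.AllPairs using (AllPairs; []; _∷_)
import Data.List.Relation.Unary.AllPairs.Properties as AllPairs
open import Data.List.Relation.Unary.Any as Any using (here; there; satisfied)
open import Data.List.Relation.Unary.Any.Properties using (lookup-index)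
open import Data.Maybe.Base using (Maybe; just; nothing)
open import Data.Nat.Base using (ℕ; zero; suc; _+_; _*_; _∸_; _^_; _⊔_; _≤_; _<_; _≡ᵇ_; z≤n; s≤s; >-nonZero)
open import Data.Nat.Binary.Base as ℕᵇ using (ℕᵇ; 2[1+_])
open import Data.Nat.Binary.Properties using (fromℕ-toℕ)
open import Data.Nat.Logarithm using (⌈log₂_⌉)
open import Data.Nat.Properties hiding (_≟_; suc-injective)
open import Data.Nat.Tactic.RingSolver using (solve-∀)
open import Data.Product.Base using (_×_; _,_; ∃-syntax; proj₁; proj₂)
open import Data.Product.Properties using (,-injective)
open import Data.Sum.Base using (_⊎_; inj₁; inj₂; [_,_]′; swap)
open import Data.Unit.Base using (⊤; tt)
open import Data.Vec.Base as Vec using (Vec; _[_]≔_)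
import Data.Vec.Functional as Functional
open import Data.Vec.Functional using (updateAt)
open import Data.Vec.Functional.Properties using (updateAt-updates; updateAt-minimal)
open import Data.Vec.Relation.Unary.Any.Properties using (toList⁺; toList⁻)
open import Function.Base using (_∘_)
open import Function.Bundles using (_⇔_; mk⇔; Equivalence)
open import Function.Construct.Composition using (_⇔-∘_)
open import Relation.Binary.Construct.Closure.ReflexiveTransitive as Star using (Star)
open import Relation.Binary.Definitions using (tri<; tri≈; tri>)
open import Relation.Binary.PropositionalEquality
open import Relation.Nullary using (¬_; yes; no)

-- The obstacle is that nobody can remember a clause number. The memory is a single cell, so the
-- number is lost as soon as the token is written, and neither the threads nor the controller may
-- have a number of states that grows with the formula. The number therefore has to be guessed anew
-- in every round, and the guess has to be checked in a distributed way. The token doubles as a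
-- barrier: a thread accepts it only after having followed the last number. Since a wrong guess is
-- exposed no earlier than this, the invariant of the soundness proof carries two clause indices,
-- the one being left and the one being announced, and identifies them only once all threads are
-- known to have moved. The parameter of the instance is a constant times n + 1, which a function in
-- o(n) tolerates. What remains is to bound the running time of the reduction on the concrete
-- machine; restricting the reduction to a language with bounded loops yields polynomial bounds by
-- recursion on the syntax.

-- Polynomial-time tree functions

-- A first-order language of tree functions of polynomial growth: its only
-- loops pass through the suffixes of a list (a unary numeral is one, too) and
-- either discard elements of another list or push onto an output list.

mutual
  data Term (k : ℕ) : Set where
    var       : Fin k → Term k
    nil       : Term k
    cons drop : Term k → Term k → Term k
    hd tl     : Term k → Term k
    bind      : Term k → Term (suc k) → Term k
    build     : Builder k → Term k

  data Builder (k : ℕ) : Set where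
    none : Builder k
    emit : Term k → Builder k
    _⊕_  : Builder k → Builder k → Builder k
    when : Term k → Builder k → Builder k → Builder k
    for  : Term k → Builder (suc k) → Builder k

truthy : Tree → Bool
truthy nil     = false
truthy (_ ∙ _) = true

dropᵗ : Tree → Tree → Tree
dropᵗ nil     t = t
dropᵗ (_ ∙ r) t = dropᵗ r (tlᵗ t)

-- The output of later iterations comes first, as it is pushed later.
gather : (Tree → List Tree) → Tree → List Tree
gather f nil     = []
gather f (l ∙ r) = gather f r ++ f (l ∙ r)

mutual
  ⟦_⟧ : ∀ {k} → Term k → Vec Tree k → Tree
  ⟦ var x ⟧    ρ = Vec.lookup ρ x
  ⟦ nil ⟧      ρ = nil
  ⟦ cons e f ⟧ ρ = ⟦ e ⟧ ρ ∙ ⟦ f ⟧ ρ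
  ⟦ drop e f ⟧ ρ = dropᵗ (⟦ e ⟧ ρ) (⟦ f ⟧ ρ)
  ⟦ hd e ⟧     ρ = hdᵗ (⟦ e ⟧ ρ)
  ⟦ tl e ⟧     ρ = tlᵗ (⟦ e ⟧ ρ)
  ⟦ bind e f ⟧ ρ = ⟦ f ⟧ (⟦ e ⟧ ρ Vec.∷ ρ)
  ⟦ build b ⟧  ρ = enc-trees (⟦ b ⟧ᴮ ρ)

  ⟦_⟧ᴮ : ∀ {k} → Builder k → Vec Tree k → List Tree
  ⟦ none ⟧ᴮ       ρ = []
  ⟦ emit e ⟧ᴮ     ρ = ⟦ e ⟧ ρ ∷ []
  ⟦ b ⊕ c ⟧ᴮ      ρ = ⟦ b ⟧ᴮ ρ ++ ⟦ c ⟧ᴮ ρ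
  ⟦ when e b c ⟧ᴮ ρ = ifᵇ truthy (⟦ e ⟧ ρ) then ⟦ b ⟧ᴮ ρ else ⟦ c ⟧ᴮ ρ
  ⟦ for e b ⟧ᴮ    ρ = gather (λ w → ⟦ b ⟧ᴮ (w Vec.∷ ρ)) (⟦ e ⟧ ρ)

-- Bounds on the size of values

1≤size : ∀ t → 1 ≤ size t
1≤size nil     = s≤s z≤n
1≤size (_ ∙ _) = s≤s z≤n

size-hdᵗ : ∀ t → size (hdᵗ t) ≤ size t
size-hdᵗ nil     = ≤-refl
size-hdᵗ (l ∙ r) = m≤n⇒m≤1+n (m≤m+n (size l) (size r))

size-tlᵗ : ∀ t → size (tlᵗ t) ≤ size t
size-tlᵗ nil     = ≤-refl
size-tlᵗ (l ∙ r) = m≤n⇒m≤1+n (m≤n+m (size r) (size l))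

size-dropᵗ : ∀ s t → size (dropᵗ s t) ≤ size t
size-dropᵗ nil     t = ≤-refl
size-dropᵗ (_ ∙ r) t = ≤-trans (size-dropᵗ r (tlᵗ t)) (size-tlᵗ t)

size-++ : ∀ xs ys → size (enc-trees (xs ++ ys)) ≤ size (enc-trees xs) + size (enc-trees ys)
size-++ []       ys = n≤1+n _
size-++ (x ∷ xs) ys = s≤s (begin
  size x + size (enc-trees (xs ++ ys))                    ≤⟨ +-monoʳ-≤ (size x) (size-++ xs ys) ⟩
  size x + (size (enc-trees xs) + size (enc-trees ys))    ≡⟨ +-assoc (size x) _ _ ⟨
  size x + size (enc-trees xs) + size (enc-trees ys)      ∎)
  where open ≤-Reasoning

size-gather : ∀ {M} f t → (∀ w → size w ≤ size t → size (enc-trees (f w)) ≤ M) →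
  size (enc-trees (gather f t)) ≤ 1 + size t * M
size-gather         f nil     h = s≤s z≤n
size-gather {M = M} f (l ∙ r) h = begin
  size (enc-trees (gather f r ++ f (l ∙ r)))  ≤⟨ size-++ (gather f r) _ ⟩
  size (enc-trees (gather f r)) + size (enc-trees (f (l ∙ r)))
    ≤⟨ +-mono-≤ (size-gather f r (λ w w≤r → h w (≤-trans w≤r (size-tlᵗ (l ∙ r))))) (h (l ∙ r) ≤-refl) ⟩
  1 + size r * M + M                          ≡⟨ cong suc (+-comm (size r * M) M) ⟩
  1 + suc (size r) * M                        ≤⟨ s≤s (*-monoˡ-≤ M (s≤s (m≤n+m (size r) (size l)))) ⟩
  1 + size (l ∙ r) * M                        ∎
  where open ≤-Reasoning

mutual
  -- Here N bounds the entries of the environment. Under a binder the bound becomes the sum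
  -- `N + sizeᵀ e N`, which dominates the old entries as well as the new one; being at least N, it
  -- is also admissible for composing polynomial bounds.
  sizeᵀ : ∀ {k} → Term k → ℕ → ℕ
  sizeᵀ (var x)    N = N
  sizeᵀ nil        N = 1
  sizeᵀ (cons e f) N = 1 + sizeᵀ e N + sizeᵀ f N
  sizeᵀ (drop e f) N = sizeᵀ f N
  sizeᵀ (hd e)     N = sizeᵀ e N
  sizeᵀ (tl e)     N = sizeᵀ e N
  sizeᵀ (bind e f) N = sizeᵀ f (N + sizeᵀ e N)
  sizeᵀ (build b)  N = sizeᴮ b N

  sizeᴮ : ∀ {k} → Builder k → ℕ → ℕ
  sizeᴮ none         N = 1
  sizeᴮ (emit e)     N = 1 + sizeᵀ e N + 1
  sizeᴮ (b ⊕ c)      N = sizeᴮ b N + sizeᴮ c N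
  sizeᴮ (when e b c) N = sizeᴮ b N + sizeᴮ c N
  sizeᴮ (for e b)    N = 1 + sizeᵀ e N * sizeᴮ b (N + sizeᵀ e N)

Bounded : ∀ {k} → ℕ → Vec Tree k → Set
Bounded N ρ = ∀ x → size (Vec.lookup ρ x) ≤ N

extend : ∀ {k N M t} {ρ : Vec Tree k} → Bounded N ρ → size t ≤ M → Bounded (N + M) (t Vec.∷ ρ)
extend {N = N} {M} h t≤M zero    = ≤-trans t≤M (m≤n+m M N)
extend {N = N} {M} h t≤M (suc x) = ≤-trans (h x) (m≤m+n N M)

mutual
  size-⟦⟧ : ∀ {k N} (e : Term k) {ρ} → Bounded N ρ → size (⟦ e ⟧ ρ) ≤ sizeᵀ e N
  size-⟦⟧ (var x)    h = h x
  size-⟦⟧ nil        h = ≤-refl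
  size-⟦⟧ (cons e f) h = s≤s (+-mono-≤ (size-⟦⟧ e h) (size-⟦⟧ f h))
  size-⟦⟧ (drop e f) {ρ} h = ≤-trans (size-dropᵗ (⟦ e ⟧ ρ) (⟦ f ⟧ ρ)) (size-⟦⟧ f h)
  size-⟦⟧ (hd e)     {ρ} h = ≤-trans (size-hdᵗ (⟦ e ⟧ ρ)) (size-⟦⟧ e h)
  size-⟦⟧ (tl e)     {ρ} h = ≤-trans (size-tlᵗ (⟦ e ⟧ ρ)) (size-⟦⟧ e h)
  size-⟦⟧ (bind e f) h = size-⟦⟧ f (extend h (size-⟦⟧ e h))
  size-⟦⟧ (build b)  h = size-⟦⟧ᴮ b h

  size-⟦⟧ᴮ : ∀ {k N} (b : Builder k) {ρ} → Bounded N ρ → size (enc-trees (⟦ b ⟧ᴮ ρ)) ≤ sizeᴮ b N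
  size-⟦⟧ᴮ none     h = ≤-refl
  size-⟦⟧ᴮ (emit e) h = s≤s (+-monoˡ-≤ 1 (size-⟦⟧ e h))
  size-⟦⟧ᴮ (b ⊕ c)  {ρ} h = ≤-trans (size-++ (⟦ b ⟧ᴮ ρ) _) (+-mono-≤ (size-⟦⟧ᴮ b h) (size-⟦⟧ᴮ c h))
  size-⟦⟧ᴮ (when e b c) {ρ} h with truthy (⟦ e ⟧ ρ)
  ... | true  = ≤-trans (size-⟦⟧ᴮ b h) (m≤m+n _ _)
  ... | false = ≤-trans (size-⟦⟧ᴮ c h) (m≤n+m _ _)
  size-⟦⟧ᴮ {N = N} (for e b) {ρ} h = ≤-trans
    (size-gather _ (⟦ e ⟧ ρ) λ w w≤ → size-⟦⟧ᴮ b (extend h (≤-trans w≤ (size-⟦⟧ e h))))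
    (s≤s (*-monoˡ-≤ (sizeᴮ b (N + sizeᵀ e N)) (size-⟦⟧ e h)))

-- Compilation and running time

-- Compilation to two registers: E holds the list of the values of the
-- variables, S a stack of intermediate results.

E S : ∀ {l} → Fin (2 + l)
E = zero
S = suc zero

nth : ∀ {k l} → Fin k → Expr l → Expr l
nth zero    e = hd e
nth (suc x) e = nth x (tl e)

top₁ top₂ rest₁ rest₂ : ∀ {l} → Expr (2 + l)
top₁  = hd (var S)
rest₁ = tl (var S)
top₂  = hd rest₁
rest₂ = tl rest₁

mutual
  compile : ∀ {k l} → Term k → Cmd (2 + l)
  compile (var x)    = S ≔ cons (nth x (var E)) (var S)
  compile nil        = S ≔ cons nil (var S)
  compile (cons e f) = compile e ⨾ compile f ⨾ S ≔ cons (cons top₂ top₁) rest₂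
  compile (drop e f) = compile e ⨾ compile f ⨾
    while top₂ loop (S ≔ cons (tl top₁) (cons (tl top₂) rest₂)) ⨾
    S ≔ cons top₁ rest₂
  compile (hd e)     = compile e ⨾ S ≔ cons (hd top₁) rest₁
  compile (tl e)     = compile e ⨾ S ≔ cons (tl top₁) rest₁
  compile (bind e f) = compile e ⨾ E ≔ cons top₁ (var E) ⨾ S ≔ rest₁ ⨾ compile f ⨾ E ≔ tl (var E)
  compile (build b)  = S ≔ cons nil (var S) ⨾ compileᴮ b

  -- A builder pushes its output onto the list on top of the stack, so the right operand of `⊕` has
  -- to run first.
  compileᴮ : ∀ {k l} → Builder k → Cmd (2 + l)
  compileᴮ none         = skip
  compileᴮ (emit e)     = compile e ⨾ S ≔ cons (cons top₁ top₂) rest₂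
  compileᴮ (b ⊕ c)      = compileᴮ c ⨾ compileᴮ b
  compileᴮ (when e b c) = compile e ⨾
    if top₁ then S ≔ rest₁ ⨾ compileᴮ b else (S ≔ rest₁ ⨾ compileᴮ c)
  compileᴮ (for e b)    = compile e ⨾ while top₁ loop iteration b ⨾ S ≔ rest₁

  -- During the body the current suffix lives in `E` only, so that the output list is on top of the
  -- stack; afterwards the next suffix is recovered from `E`.
  iteration : ∀ {k l} → Builder (suc k) → Cmd (2 + l)
  iteration b = E ≔ cons top₁ (var E) ⨾ S ≔ rest₁ ⨾ compileᴮ b ⨾
    S ≔ cons (tl (hd (var E))) (var S) ⨾ E ≔ tl (var E)

Runs : ∀ {l} → Cmd l → Store l → ℕ → Store l → Set
Runs C σ T σ′ = ∃[ τ ] τ ≤ T × ⟨ C , σ ⟩⇓[ τ ] σ′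

assigns : ∀ {l} {σ : Store l} {x} e → Runs (x ≔ e) σ (1 + cost e) (σ [ x ]≔ eval e σ)
assigns e = _ , ≤-refl , assign

infixr 4 _then_

_then_ : ∀ {l C D T U} {σ σ′ σ″ : Store l} → Runs C σ T σ′ → Runs D σ′ U σ″ → Runs (C ⨾ D) σ (T + U) σ″
(_ , τ≤ , C⇓) then (_ , υ≤ , D⇓) = _ , +-mono-≤ τ≤ υ≤ , seq C⇓ D⇓

weaken : ∀ {l C T U} {σ σ′ : Store l} → T ≤ U → Runs C σ T σ′ → Runs C σ U σ′
weaken T≤U (τ , τ≤T , C⇓) = τ , ≤-trans τ≤T T≤U , C⇓

envTree : ∀ {k} → Vec Tree k → Tree
envTree ρ = enc-trees (Vec.toList ρ)

eval-nth : ∀ {k l} (x : Fin k) {ρ} (e : Expr l) {σ} → eval e σ ≡ envTree ρ → eval (nth x e) σ ≡ Vec.lookup ρ x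
eval-nth zero    {t Vec.∷ ρ} e eq = cong hdᵗ eq
eval-nth (suc x) {t Vec.∷ ρ} e eq = eval-nth x (tl e) (cong tlᵗ eq)

cost-nth : ∀ {k l} (x : Fin k) (e : Expr l) → cost (nth x e) ≤ k + cost e
cost-nth {k = suc k} zero    e = s≤s (m≤n+m _ k)
cost-nth {k = suc k} (suc x) e = ≤-trans (cost-nth x (tl e)) (≤-reflexive (+-suc k (cost e)))

-- The additive constants are the costs of the assignments and tests that
-- surround the compiled subterms.
mutual
  timeᵀ : ∀ {k} → Term k → ℕ → ℕ
  timeᵀ {k} (var x) N = 1 + (1 + (k + 1) + 1)
  timeᵀ nil        N = 4
  timeᵀ (cons e f) N = timeᵀ e N + (timeᵀ f N + 11)
  timeᵀ (drop e f) N = timeᵀ e N + (timeᵀ f N + (sizeᵀ e N * 17 + 7))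
  timeᵀ (hd e)     N = timeᵀ e N + 7
  timeᵀ (tl e)     N = timeᵀ e N + 7
  timeᵀ (bind e f) N = timeᵀ e N + (5 + (3 + (timeᵀ f (N + sizeᵀ e N) + 3)))
  timeᵀ (build b)  N = 4 + timeᴮ b N

  timeᴮ : ∀ {k} → Builder k → ℕ → ℕ
  timeᴮ none         N = 1
  timeᴮ (emit e)     N = timeᵀ e N + 11
  timeᴮ (b ⊕ c)      N = timeᴮ c N + timeᴮ b N
  timeᴮ (when e b c) N = timeᵀ e N + (3 + (3 + (timeᴮ b N + timeᴮ c N)))
  timeᴮ (for e b)    N = timeᵀ e N + (sizeᵀ e N * (3 + iterationTime b (N + sizeᵀ e N)) + 3)

  iterationTime : ∀ {k} → Builder (suc k) → ℕ → ℕ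
  iterationTime b N = 5 + (3 + (timeᴮ b N + (6 + 3)))

eval-≡ : ∀ {l} {σ : Store l} {x e t} → eval e σ ≡ t → Runs (x ≔ e) σ (1 + cost e) (σ [ x ]≔ t)
eval-≡ {e = e} refl = assigns e

-- An iteration costs 4 for the test and 13 for the assignment, and shortens `s` by one cell. The
-- final failing test is paid for by the `nil` at the end of `s`.
drop-runs : ∀ {l} s t u e {σ : Store l} →
  Runs (while top₂ loop (S ≔ cons (tl top₁) (cons (tl top₂) rest₂)))
       (e Vec.∷ (t ∙ s ∙ u) Vec.∷ σ) (size s * 17) (e Vec.∷ (dropᵗ s t ∙ nil ∙ u) Vec.∷ σ)
drop-runs nil     t u e = _ , m≤m+n 4 13 , while-false refl
drop-runs (l ∙ r) t u e with drop-runs r (tlᵗ t) u e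
... | τ , τ≤ , run =
  _ , +-monoʳ-≤ 17 (≤-trans τ≤ (*-monoˡ-≤ 17 (m≤n+m (size r) (size l)))) , while-true (λ ()) assign run

-- The hypothesis is needed for every accumulator, since each iteration starts from the output of
-- its predecessors. It concerns only trees no larger than `t`, so that one environment bound serves
-- all iterations. The 3 is the cost of the test.
gather-runs : ∀ {l k T} (b : Builder (suc k)) (f : Tree → List Tree) {e} {σ : Store l} t u acc →
  (∀ w acc → size w ≤ size t →
    Runs (iteration b) (e Vec.∷ (w ∙ enc-trees acc ∙ u) Vec.∷ σ) T
         (e Vec.∷ (tlᵗ w ∙ enc-trees (f w ++ acc) ∙ u) Vec.∷ σ)) →
  Runs (while top₁ loop iteration b) (e Vec.∷ (t ∙ enc-trees acc ∙ u) Vec.∷ σ)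
       (size t * (3 + T)) (e Vec.∷ (nil ∙ enc-trees (gather f t ++ acc) ∙ u) Vec.∷ σ)
gather-runs b f nil     u acc h = _ , s≤s (s≤s (s≤s z≤n)) , while-false refl
gather-runs {T = T} b f (l ∙ r) u acc h
  rewrite ++-assoc (gather f r) (f (l ∙ r)) acc
  with h (l ∙ r) acc ≤-refl
     | gather-runs b f r u (f (l ∙ r) ++ acc) (λ w acc′ w≤r → h w acc′ (≤-trans w≤r (size-tlᵗ (l ∙ r))))
... | τ , τ≤ , body⇓ | τ′ , τ′≤ , loop⇓ =
  _ , +-mono-≤ (+-monoʳ-≤ 3 τ≤) (≤-trans τ′≤ (*-monoˡ-≤ (3 + T) (m≤n+m (size r) (size l)))) ,
  while-true (λ ()) body⇓ loop⇓

mutual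
  compile-runs : ∀ {k l N} (e : Term k) {ρ} → Bounded N ρ → ∀ u {σ : Store l} →
    Runs (compile e) (envTree ρ Vec.∷ u Vec.∷ σ) (timeᵀ e N) (envTree ρ Vec.∷ (⟦ e ⟧ ρ ∙ u) Vec.∷ σ)
  compile-runs (var x) {ρ} h u {σ} =
    weaken (s≤s (s≤s (+-monoˡ-≤ 1 (cost-nth x (var E)))))
      (eval-≡ {e = cons (nth x (var E)) (var S)}
        (cong (_∙ u) (eval-nth x (var E) {envTree ρ Vec.∷ u Vec.∷ σ} refl)))
  compile-runs nil        h u = assigns _
  compile-runs (cons e f) h u = compile-runs e h u then compile-runs f h _ then assigns _
  compile-runs {N = N} (drop e f) {ρ} h u =
    compile-runs e h u then compile-runs f h _ then
    weaken (*-monoˡ-≤ 17 (size-⟦⟧ e h)) (drop-runs (⟦ e ⟧ ρ) (⟦ f ⟧ ρ) u _) then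
    assigns _
  compile-runs (hd e)     h u = compile-runs e h u then assigns _
  compile-runs (tl e)     h u = compile-runs e h u then assigns _
  compile-runs (bind e f) h u =
    compile-runs e h u then assigns _ then assigns _ then
    compile-runs f (extend h (size-⟦⟧ e h)) u then assigns _
  compile-runs (build b) {ρ} h u = assigns _ then
    subst (λ ts → Runs (compileᴮ b) _ _ (_ Vec.∷ (enc-trees ts ∙ u) Vec.∷ _)) (++-identityʳ (⟦ b ⟧ᴮ ρ))
      (compileᴮ-runs b h u [])

  compileᴮ-runs : ∀ {k l N} (b : Builder k) {ρ} → Bounded N ρ → ∀ u acc {σ : Store l} →
    Runs (compileᴮ b) (envTree ρ Vec.∷ (enc-trees acc ∙ u) Vec.∷ σ) (timeᴮ b N)
         (envTree ρ Vec.∷ (enc-trees (⟦ b ⟧ᴮ ρ ++ acc) ∙ u) Vec.∷ σ)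
  compileᴮ-runs none     h u acc = _ , ≤-refl , skip
  compileᴮ-runs (emit e) h u acc = compile-runs e h _ then assigns _
  compileᴮ-runs (b ⊕ c) {ρ} h u acc rewrite ++-assoc (⟦ b ⟧ᴮ ρ) (⟦ c ⟧ᴮ ρ) acc =
    compileᴮ-runs c h u acc then compileᴮ-runs b h u (⟦ c ⟧ᴮ ρ ++ acc)
  compileᴮ-runs (when e b c) {ρ} h u acc = compile-runs e h _ then branch (⟦ e ⟧ ρ)
    where
    branch : ∀ t → Runs _ (envTree ρ Vec.∷ (t ∙ enc-trees acc ∙ u) Vec.∷ _) _
      (envTree ρ Vec.∷ (enc-trees ((ifᵇ truthy t then ⟦ b ⟧ᴮ ρ else ⟦ c ⟧ᴮ ρ) ++ acc) ∙ u) Vec.∷ _)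
    branch nil with assigns rest₁ then compileᴮ-runs c h u acc
    ... | _ , τ≤ , run = _ , +-monoʳ-≤ 3 (≤-trans τ≤ (+-monoʳ-≤ 3 (m≤n+m _ _))) , if-false refl run
    branch (_ ∙ _) with assigns rest₁ then compileᴮ-runs b h u acc
    ... | _ , τ≤ , run = _ , +-monoʳ-≤ 3 (≤-trans τ≤ (+-monoʳ-≤ 3 (m≤m+n _ _))) , if-true (λ ()) run
  compileᴮ-runs {N = N} (for e b) {ρ} h u acc =
    compile-runs e h _ then
    weaken (*-monoˡ-≤ (3 + iterationTime b (N + sizeᵀ e N)) (size-⟦⟧ e h))
      (gather-runs b _ (⟦ e ⟧ ρ) u acc λ w acc′ w≤ →
        assigns _ then assigns _ then
        compileᴮ-runs b (extend h (≤-trans w≤ (size-⟦⟧ e h))) u acc′ then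
        assigns _ then assigns _) then
    assigns _

-- Polynomial growth; arguments below 2 are disregarded, so that a single
-- exponent can serve as bound.
Polynomial : (ℕ → ℕ) → Set
Polynomial p = ∃[ c ] (∀ N → 2 ≤ N → p N ≤ N ^ c)

^-≥1 : ∀ {N} c → 2 ≤ N → 1 ≤ N ^ c
^-≥1 {N} c 2≤N = m^n>0 N c
  where instance _ = >-nonZero (≤-trans (s≤s z≤n) 2≤N)

polynomial-const : ∀ a → Polynomial (λ _ → a)
polynomial-const a = a , λ N 2≤N → ≤-trans (<⇒≤ (n<2^n a)) (^-monoˡ-≤ a 2≤N)
  where
  n<2^n : ∀ n → n < 2 ^ n
  n<2^n zero    = s≤s z≤n
  n<2^n (suc n) = ≤-trans (+-mono-≤ (^-≥1 {2} n ≤-refl) (n<2^n n)) (≤-reflexive (cong (2 ^ n +_) (sym (+-identityʳ _))))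

polynomial-id : Polynomial (λ N → N)
polynomial-id = 1 , λ N _ → ≤-reflexive (sym (*-identityʳ N))

polynomial-* : ∀ {p q} → Polynomial p → Polynomial q → Polynomial (λ N → p N * q N)
polynomial-* (c , hp) (d , hq) = c + d , λ N 2≤N →
  ≤-trans (*-mono-≤ (hp N 2≤N) (hq N 2≤N)) (≤-reflexive (sym (^-distribˡ-+-* N c d)))

infixr 6 _⊞_

-- Both summands are at most `N ^ (c + d)`, and the factor 2 that arises is at most N.
_⊞_ : ∀ {p q} → Polynomial p → Polynomial q → Polynomial (λ N → p N + q N)
_⊞_ {p} {q} (c , hp) (d , hq) = 1 + (c + d) , λ N 2≤N →
  let open ≤-Reasoning
      c≤ = ≤-trans (hp N 2≤N) (^-monoʳ-≤ N {{>-nonZero (≤-trans (s≤s z≤n) 2≤N)}} (m≤m+n c d))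
      d≤ = ≤-trans (hq N 2≤N) (^-monoʳ-≤ N {{>-nonZero (≤-trans (s≤s z≤n) 2≤N)}} (m≤n+m d c))
  in begin
    p N + q N                  ≤⟨ +-mono-≤ c≤ d≤ ⟩
    N ^ (c + d) + N ^ (c + d)  ≡⟨ cong (N ^ (c + d) +_) (+-identityʳ _) ⟨
    2 * N ^ (c + d)            ≤⟨ *-monoˡ-≤ (N ^ (c + d)) 2≤N ⟩
    N * N ^ (c + d)            ∎

-- As `q` does not decrease its argument, the bound for `p` is never invoked below 2.
polynomial-∘ : ∀ {p q} → (∀ N → N ≤ q N) → Polynomial p → Polynomial q → Polynomial (λ N → p (q N))
polynomial-∘ {p} {q} N≤q (c , hp) (d , hq) = d * c , λ N 2≤N →
  let open ≤-Reasoning in begin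
    p (q N)      ≤⟨ hp (q N) (≤-trans 2≤N (N≤q N)) ⟩
    q N ^ c      ≤⟨ ^-monoˡ-≤ c (hq N 2≤N) ⟩
    (N ^ d) ^ c  ≡⟨ ^-*-assoc N d c ⟩
    N ^ (d * c)  ∎

mutual
  sizeᵀ-polynomial : ∀ {k} (e : Term k) → Polynomial (sizeᵀ e)
  sizeᵀ-polynomial (var x)    = polynomial-id
  sizeᵀ-polynomial nil        = polynomial-const 1
  sizeᵀ-polynomial (cons e f) = polynomial-const 1 ⊞ sizeᵀ-polynomial e ⊞ sizeᵀ-polynomial f
  sizeᵀ-polynomial (drop e f) = sizeᵀ-polynomial f
  sizeᵀ-polynomial (hd e)     = sizeᵀ-polynomial e
  sizeᵀ-polynomial (tl e)     = sizeᵀ-polynomial e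
  sizeᵀ-polynomial (bind e f) = in-extended-env e (sizeᵀ-polynomial f)
  sizeᵀ-polynomial (build b)  = sizeᴮ-polynomial b

  sizeᴮ-polynomial : ∀ {k} (b : Builder k) → Polynomial (sizeᴮ b)
  sizeᴮ-polynomial none         = polynomial-const 1
  sizeᴮ-polynomial (emit e)     = polynomial-const 1 ⊞ sizeᵀ-polynomial e ⊞ polynomial-const 1
  sizeᴮ-polynomial (b ⊕ c)      = sizeᴮ-polynomial b ⊞ sizeᴮ-polynomial c
  sizeᴮ-polynomial (when e b c) = sizeᴮ-polynomial b ⊞ sizeᴮ-polynomial c
  sizeᴮ-polynomial (for e b)    = polynomial-const 1 ⊞
    polynomial-* (sizeᵀ-polynomial e) (in-extended-env e (sizeᴮ-polynomial b))

  in-extended-env : ∀ {k p} (e : Term k) → Polynomial p → Polynomial (λ N → p (N + sizeᵀ e N))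
  in-extended-env e hp = polynomial-∘ (λ N → m≤m+n N _) hp (polynomial-id ⊞ sizeᵀ-polynomial e)

mutual
  timeᵀ-polynomial : ∀ {k} (e : Term k) → Polynomial (timeᵀ e)
  timeᵀ-polynomial (var x)    = polynomial-const _
  timeᵀ-polynomial nil        = polynomial-const 4
  timeᵀ-polynomial (cons e f) = timeᵀ-polynomial e ⊞ timeᵀ-polynomial f ⊞ polynomial-const 11
  timeᵀ-polynomial (drop e f) = timeᵀ-polynomial e ⊞ timeᵀ-polynomial f ⊞
    polynomial-* (sizeᵀ-polynomial e) (polynomial-const 17) ⊞ polynomial-const 7
  timeᵀ-polynomial (hd e)     = timeᵀ-polynomial e ⊞ polynomial-const 7
  timeᵀ-polynomial (tl e)     = timeᵀ-polynomial e ⊞ polynomial-const 7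
  timeᵀ-polynomial (bind e f) = timeᵀ-polynomial e ⊞ polynomial-const 5 ⊞ polynomial-const 3 ⊞
    in-extended-env e (timeᵀ-polynomial f) ⊞ polynomial-const 3
  timeᵀ-polynomial (build b)  = polynomial-const 4 ⊞ timeᴮ-polynomial b

  timeᴮ-polynomial : ∀ {k} (b : Builder k) → Polynomial (timeᴮ b)
  timeᴮ-polynomial none         = polynomial-const 1
  timeᴮ-polynomial (emit e)     = timeᵀ-polynomial e ⊞ polynomial-const 11
  timeᴮ-polynomial (b ⊕ c)      = timeᴮ-polynomial c ⊞ timeᴮ-polynomial b
  timeᴮ-polynomial (when e b c) = timeᵀ-polynomial e ⊞ polynomial-const 3 ⊞ polynomial-const 3 ⊞
    timeᴮ-polynomial b ⊞ timeᴮ-polynomial c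
  timeᴮ-polynomial (for e b)    = timeᵀ-polynomial e ⊞
    polynomial-* (sizeᵀ-polynomial e) (polynomial-const 3 ⊞ in-extended-env e
      (polynomial-const 5 ⊞ polynomial-const 3 ⊞ timeᴮ-polynomial b ⊞ polynomial-const 9)) ⊞
    polynomial-const 3

-- Transfer of solvability along a reduction

-- The compiled reduction occupies register 1 with its stack, so the given
-- algorithm has to be moved past it.

skip₁ : ∀ {k} → Fin (suc k) → Fin (2 + k)
skip₁ zero    = zero
skip₁ (suc x) = suc (suc x)

skip₁ᴱ : ∀ {k} → Expr (suc k) → Expr (2 + k)
skip₁ᴱ (var x)    = var (skip₁ x)
skip₁ᴱ nil        = nil
skip₁ᴱ (cons e f) = cons (skip₁ᴱ e) (skip₁ᴱ f)
skip₁ᴱ (hd e)     = hd (skip₁ᴱ e)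
skip₁ᴱ (tl e)     = tl (skip₁ᴱ e)

skip₁ᶜ : ∀ {k} → Cmd (suc k) → Cmd (2 + k)
skip₁ᶜ skip                   = skip
skip₁ᶜ (x ≔ e)                = skip₁ x ≔ skip₁ᴱ e
skip₁ᶜ (C ⨾ D)                = skip₁ᶜ C ⨾ skip₁ᶜ D
skip₁ᶜ (if e then C else D)   = if skip₁ᴱ e then skip₁ᶜ C else skip₁ᶜ D
skip₁ᶜ (while e loop C)       = while skip₁ᴱ e loop skip₁ᶜ C

insert₁ : ∀ {k} → Tree → Store (suc k) → Store (2 + k)
insert₁ u (t Vec.∷ σ) = t Vec.∷ u Vec.∷ σ

eval-skip₁ : ∀ {k} (e : Expr (suc k)) u σ → eval (skip₁ᴱ e) (insert₁ u σ) ≡ eval e σ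
eval-skip₁ (var zero)    u (t Vec.∷ σ) = refl
eval-skip₁ (var (suc x)) u (t Vec.∷ σ) = refl
eval-skip₁ nil           u σ = refl
eval-skip₁ (cons e f)    u σ = cong₂ _∙_ (eval-skip₁ e u σ) (eval-skip₁ f u σ)
eval-skip₁ (hd e)        u σ = cong hdᵗ (eval-skip₁ e u σ)
eval-skip₁ (tl e)        u σ = cong tlᵗ (eval-skip₁ e u σ)

cost-skip₁ : ∀ {k} (e : Expr (suc k)) → cost (skip₁ᴱ e) ≡ cost e
cost-skip₁ (var x)    = refl
cost-skip₁ nil        = refl
cost-skip₁ (cons e f) = cong suc (cong₂ _+_ (cost-skip₁ e) (cost-skip₁ f))
cost-skip₁ (hd e)     = cong suc (cost-skip₁ e)
cost-skip₁ (tl e)     = cong suc (cost-skip₁ e)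

update-skip₁ : ∀ {k} x u t (σ : Store (suc k)) → insert₁ u σ [ skip₁ x ]≔ t ≡ insert₁ u (σ [ x ]≔ t)
update-skip₁ zero    u t (s Vec.∷ σ) = refl
update-skip₁ (suc x) u t (s Vec.∷ σ) = refl

skip₁-runs : ∀ {k} {C : Cmd (suc k)} {σ τ σ′} u → ⟨ C , σ ⟩⇓[ τ ] σ′ →
  ⟨ skip₁ᶜ C , insert₁ u σ ⟩⇓[ τ ] insert₁ u σ′
skip₁-runs u skip = skip
skip₁-runs u (assign {σ} {x} {e})
  rewrite sym (cost-skip₁ e) | sym (eval-skip₁ e u σ) | sym (update-skip₁ x u (eval (skip₁ᴱ e) (insert₁ u σ)) σ) = assign
skip₁-runs u (seq r s) = seq (skip₁-runs u r) (skip₁-runs u s)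
skip₁-runs u (if-true {σ} {e = e} e≢ r)
  rewrite sym (cost-skip₁ e) | sym (eval-skip₁ e u σ) = if-true e≢ (skip₁-runs u r)
skip₁-runs u (if-false {σ} {e = e} e≡ r)
  rewrite sym (cost-skip₁ e) | sym (eval-skip₁ e u σ) = if-false e≡ (skip₁-runs u r)
skip₁-runs u (while-true {σ} {e = e} e≢ r s)
  rewrite sym (cost-skip₁ e) | sym (eval-skip₁ e u σ) = while-true e≢ (skip₁-runs u r) (skip₁-runs u s)
skip₁-runs u (while-false {σ} {e} e≡)
  rewrite sym (cost-skip₁ e) | sym (eval-skip₁ e u σ) = while-false e≡

-- For n ≥ 1 the argument `suc n * K` is at most 2K · n. Applying the hypothesis with the constant
-- 2K · c lets the factor 2K cancel; the threshold `suc N` guarantees n ≥ 1.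
littleO-∘ : ∀ {f} K → 1 ≤ K → LittleO f → LittleO (λ n → f (suc n * K))
littleO-∘ {f} K 1≤K o c with o ((2 * K) * c)
... | N , h = suc N , λ n N<n → *-cancelˡ-≤ (2 * K) {{>-nonZero (≤-trans 1≤K (m≤m+n K _))}} (begin
  2 * K * (c * f (suc n * K))  ≡⟨ *-assoc (2 * K) c _ ⟨
  2 * K * c * f (suc n * K)    ≤⟨ h (suc n * K) (begin
      N          ≤⟨ ≤-trans (n≤1+n N) (m≤n⇒m≤1+n N<n) ⟩
      suc n      ≡⟨ *-identityʳ (suc n) ⟨
      suc n * 1  ≤⟨ *-monoʳ-≤ (suc n) 1≤K ⟩
      suc n * K  ∎) ⟩
  suc n * K                    ≤⟨ *-monoˡ-≤ K (+-monoˡ-≤ n (≤-trans (s≤s z≤n) N<n)) ⟩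
  (n + n) * K                  ≡⟨ cong (λ m → (n + m) * K) (+-identityʳ n) ⟨
  2 * n * K                    ≡⟨ *-assoc 2 n K ⟩
  2 * (n * K)                  ≡⟨ cong (2 *_) (*-comm n K) ⟩
  2 * (K * n)                  ≡⟨ *-assoc 2 K n ⟨
  2 * K * n                    ∎)
  where open ≤-Reasoning

polynomial-^ : ∀ {p} c → Polynomial p → Polynomial (λ N → p N ^ c)
polynomial-^ c (d , hp) = d * c , λ N 2≤N →
  ≤-trans (^-monoˡ-≤ c (hp N 2≤N)) (≤-reflexive (^-*-assoc N d c))

-- That the reduction is given by a `Term` supplies both its running time and the size of its
-- result. Both are polynomial in the input size, hence disappear in the polynomial factor of the
-- time bound, while the exponent changes only from κ to a linear function of κ.
solvable-via-reduction : ∀ {𝒫 𝒬 κ κ′} K → 1 ≤ K →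
  (e : Term 1) (f : Problem.Instance 𝒫 → Problem.Instance 𝒬) →
  (∀ x → 2 ≤ size (Problem.encode 𝒫 x)) →
  (∀ x → ⟦ e ⟧ (Problem.encode 𝒫 x Vec.∷ Vec.[]) ≡ Problem.encode 𝒬 (f x)) →
  (∀ x → Problem.Yes 𝒬 (f x) ⇔ Problem.Yes 𝒫 x) →
  (∀ x → κ′ (f x) ≡ suc (κ x) * K) →
  SolvableInTime2^o 𝒬 κ′ → SolvableInTime2^o 𝒫 κ
solvable-via-reduction {𝒫} {𝒬} {κ} {κ′} K 1≤K e f 2≤size e-computes-f f-correct κ′∘f
  (A , g , c , g-littleO , A-decides) =
  record { aux = suc aux ; body = body′ } ,
  (λ n → g (suc n * K)) , proj₁ p-polynomial , littleO-∘ {g} K 1≤K g-littleO , record { decides = decides′ }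
  where
  open Problem
  open Algorithm A

  body′ : Cmd (2 + aux)
  -- The input is wrapped as a one-element environment. The compiled term touches only `E` and `S`,
  -- so the given algorithm finds its auxiliary variables still `nil`.
  body′ = E ≔ cons (var E) nil ⨾ compile e ⨾ E ≔ top₁ ⨾ S ≔ nil ⨾ skip₁ᶜ body

  p : ℕ → ℕ
  -- The constants 4, 3 and 2 are the costs of the three assignments in `body′`.
  p N = 4 + (timeᵀ e N + (3 + (2 + sizeᵀ e N ^ c)))

  p-polynomial : Polynomial p
  p-polynomial = polynomial-const 4 ⊞ timeᵀ-polynomial e ⊞ polynomial-const 5 ⊞ polynomial-^ c (sizeᵀ-polynomial e)

  decides′ : ∀ x → ∃[ τ ] ∃[ out ] ∃[ σ ]
    ⟨ body′ , encode 𝒫 x Vec.∷ Vec.replicate (suc aux) nil ⟩⇓[ τ ] (out Vec.∷ σ)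
    × (out ≢ nil ⇔ Yes 𝒫 x) × τ ≤ 2 ^ g (suc (κ x) * K) * size (encode 𝒫 x) ^ proj₁ p-polynomial
  decides′ x with DecidesIn.decides A-decides (f x)
  ... | τ , out , σ , run , out-correct , τ≤ = _ , out , _ , proj₂ (proj₂ total) , f-correct x ⇔-∘ out-correct ,
    (begin
      proj₁ total                ≤⟨ proj₁ (proj₂ total) ⟩
      4 + (timeᵀ e N + (3 + (2 + τ)))
        ≤⟨ +-monoʳ-≤ 4 (+-monoʳ-≤ (timeᵀ e N) (+-monoʳ-≤ 5 (≤-trans τ≤ bound))) ⟩
      4 + (timeᵀ e N + (5 + G * sizeᵀ e N ^ c))
        ≤⟨ +-mono-≤ (m≤n*m 4 G) (+-mono-≤ (m≤n*m (timeᵀ e N) G) (+-monoˡ-≤ (G * sizeᵀ e N ^ c) (m≤n*m 5 G))) ⟩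
      G * 4 + (G * timeᵀ e N + (G * 5 + G * sizeᵀ e N ^ c))  ≡⟨ factor ⟨
      G * p N                    ≤⟨ *-monoʳ-≤ G (proj₂ p-polynomial N (2≤size x)) ⟩
      G * N ^ proj₁ p-polynomial ∎)
    where
    open ≤-Reasoning
    N G : ℕ
    N = size (encode 𝒫 x)
    G = 2 ^ g (suc (κ x) * K)

    instance _ = m^n≢0 2 (g (suc (κ x) * K))

    bounded : Bounded N (encode 𝒫 x Vec.∷ Vec.[])
    bounded zero = ≤-refl

    total : Runs body′ (encode 𝒫 x Vec.∷ Vec.replicate (suc aux) nil)
      (4 + (timeᵀ e N + (3 + (2 + τ)))) (out Vec.∷ nil Vec.∷ σ)
    total = assigns _ then compile-runs e bounded nil then assigns _ then assigns _ then
      (τ , ≤-refl , subst (λ t → ⟨ _ , t Vec.∷ _ ⟩⇓[ _ ] _) (sym (e-computes-f x)) (skip₁-runs nil run))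

    bound : 2 ^ g (κ′ (f x)) * size (encode 𝒬 (f x)) ^ c ≤ G * sizeᵀ e N ^ c
    bound = *-mono-≤ (≤-reflexive (cong (λ k → 2 ^ g k) (κ′∘f x)))
      (^-monoˡ-≤ c (subst (λ t → size t ≤ sizeᵀ e N) (e-computes-f x) (size-⟦⟧ e bounded)))

    factor : G * p N ≡ G * 4 + (G * timeᵀ e N + (G * 5 + G * sizeᵀ e N ^ c))
    factor = trans (*-distribˡ-+ G 4 _) (cong (G * 4 +_)
      (trans (*-distribˡ-+ G (timeᵀ e N) _) (cong (G * timeᵀ e N +_) (*-distribˡ-+ G 5 _))))

-- Clauses as sets of literals

bit : Bool → ℕ
bit false = 0
bit true  = 1

sameLiteral : ∀ {n} → Literal n → Literal n → Bool
sameLiteral (x , b) (y , c) = (toℕ x ≡ᵇ toℕ y) ∧ (bit b ≡ᵇ bit c)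

-- Here and below the recursive call comes first, in accordance with `gather`, where the output of
-- later iterations precedes. The loops that compute these functions can then be verified by plain
-- recursion.
member : ∀ {n} → Literal n → List (Literal n) → Bool
member l []      = false
member l (k ∷ C) = member l C ∨ sameLiteral k l

missing differ : ∀ {n} → List (Literal n) → List (Literal n) → Bool
missing []      D = false
missing (l ∷ C) D = missing C D ∨ not (member l D)
differ C D = missing C D ∨ missing D C

repeated : ∀ {n} → List (Literal n) → List (List (Literal n)) → Bool
repeated C []       = false
repeated C (D ∷ Ds) = repeated C Ds ∨ not (differ C D)

dedup : ∀ {n} → List (List (Literal n)) → List (List (Literal n))
dedup []       = []
dedup (C ∷ Cs) = dedup Cs ++ (ifᵇ repeated C Cs then [] else (C ∷ []))

-- The states of the threads

-- A thread in state act b p q _ has guessed the truth value b of its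
-- variable, and the current clause contains the variable itself iff p, and
-- its negation iff q.

data Phase : Set where
  marked idle : Phase
  pass        : Bool → Phase

data State : Set where
  init end ask choose release : State
  act                         : (b p q : Bool) → Phase → State

sat : Bool → Bool → Bool → Bool
sat b p q = ifᵇ b then p else q

booleans : List Bool
booleans = true ∷ false ∷ []

quadruples : List (Bool × Bool × Bool × Bool)
quadruples = cartesianProduct booleans (cartesianProduct booleans (cartesianProduct booleans booleans))

∈-booleans : ∀ b → b ∈ booleans
∈-booleans true  = here refl
∈-booleans false = there (here refl)

∈-quadruples : ∀ b p q s → (b , p , q , s) ∈ quadruples
∈-quadruples b p q s = ∈-cartesianProduct⁺ (∈-booleans b) (∈-cartesianProduct⁺ (∈-booleans p)
  (∈-cartesianProduct⁺ (∈-booleans q) (∈-booleans s)))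

Fin-Bool : Bool → Fin 2
Fin-Bool false = zero
Fin-Bool true  = suc zero

Fin-Phase : Phase → Fin 4
Fin-Phase marked       = zero
Fin-Phase idle         = suc zero
Fin-Phase (pass false) = suc (suc zero)
Fin-Phase (pass true)  = suc (suc (suc zero))

-- 37 = 5 + 2 · 2 · 2 · 4. The controller and the threads of the variables share one state set, so
-- the maximum over all threads is this constant.
⌊_⌋ˢ : State → Fin 37
⌊ init ⌋ˢ        = zero
⌊ end ⌋ˢ         = suc zero
⌊ ask ⌋ˢ         = suc (suc zero)
⌊ choose ⌋ˢ      = suc (suc (suc zero))
⌊ release ⌋ˢ     = suc (suc (suc (suc zero)))
⌊ act b p q φ ⌋ˢ = 5 ↑ʳ combine (Fin-Bool b) (combine (Fin-Bool p) (combine (Fin-Bool q) (Fin-Phase φ)))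

Fin-Bool-injective : ∀ b c → Fin-Bool b ≡ Fin-Bool c → b ≡ c
Fin-Bool-injective false false _ = refl
Fin-Bool-injective true  true  _ = refl

Fin-Phase-injective : ∀ φ ψ → Fin-Phase φ ≡ Fin-Phase ψ → φ ≡ ψ
Fin-Phase-injective marked       marked       _ = refl
Fin-Phase-injective marked       (pass false) ()
Fin-Phase-injective marked       (pass true)  ()
Fin-Phase-injective idle         idle         _ = refl
Fin-Phase-injective idle         (pass false) ()
Fin-Phase-injective idle         (pass true)  ()
Fin-Phase-injective (pass false) (pass false) _ = refl
Fin-Phase-injective (pass true)  (pass true)  _ = refl
Fin-Phase-injective (pass false) marked ()
Fin-Phase-injective (pass true)  marked ()
Fin-Phase-injective (pass false) idle ()
Fin-Phase-injective (pass true)  idle ()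

⌊⌋ˢ-injective : ∀ s s′ → ⌊ s ⌋ˢ ≡ ⌊ s′ ⌋ˢ → s ≡ s′
⌊⌋ˢ-injective init    init    _ = refl
⌊⌋ˢ-injective end     end     _ = refl
⌊⌋ˢ-injective ask     ask     _ = refl
⌊⌋ˢ-injective choose  choose  _ = refl
⌊⌋ˢ-injective release release _ = refl
⌊⌋ˢ-injective (act b p q φ) (act b′ p′ q′ φ′) eq
  with b≡ , eq ← combine-injective (Fin-Bool b) _ (Fin-Bool b′) _ (↑ʳ-injective 5 _ _ eq)
  with p≡ , eq ← combine-injective (Fin-Bool p) _ (Fin-Bool p′) _ eq
  with q≡ , eq ← combine-injective (Fin-Bool q) _ (Fin-Bool q′) _ eq
  with refl ← Fin-Bool-injective b b′ b≡ | refl ← Fin-Bool-injective p p′ p≡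
     | refl ← Fin-Bool-injective q q′ q≡ | refl ← Fin-Phase-injective φ φ′ eq = refl

-- The program, with symbolic states and memory values

module Machine (n : ℕ) (L : List (List (Literal n))) where

  m : ℕ
  m = length L

  -- tok y s is a token on its way to thread y, where s tells whether it has
  -- passed a thread that satisfies the current clause; val k calls on the
  -- threads to move to clause k, counted from 0, or to finish if k = m.

  data Value : Set where
    tok : Fin (suc n) → Bool → Value
    val : Fin (suc m) → Value

  clauseAt : (L : List (List (Literal n))) → Fin (suc (length L)) → Maybe (List (Literal n))
  clauseAt []      _       = nothing
  clauseAt (C ∷ L) zero    = just C
  clauseAt (C ∷ L) (suc k) = clauseAt L k

  at : Fin n → Bool → Phase → List (Literal n) → State
  at x b φ C = act b (member (x , true) C) (member (x , false) C) φ

  at? : Fin n → Bool → Phase → Maybe (List (Literal n)) → State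
  at? x b φ nothing  = end
  at? x b φ (just C) = at x b φ C

  -- A thread is `marked` once it has followed the announced number, in `pass s` between reading the
  -- token and writing it back, and `idle` afterwards. Thread `suc x` expects the token as
  -- `inject₁ x` and forwards it as `suc x`; `fromℕ n` addresses the controller, which accepts only
  -- the flag `true`. The source state of `move x b j` depends on clause j only through two
  -- membership bits, so the rule also applies to a thread at another clause with the same bits.
  data Rule : Fin (suc n) → State → Op Value → State → Set where
    take    : ∀ x b p q s → Rule (suc x) (act b p q marked) (read (tok (inject₁ x) s)) (act b p q (pass (s ∨ sat b p q)))
    put     : ∀ x b p q s → Rule (suc x) (act b p q (pass s)) (write (tok (suc x) s)) (act b p q idle)
    enter   : ∀ x b       → Rule (suc x) init (read (val zero)) (at? x b marked (clauseAt L zero))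
    move    : ∀ x b j     → Rule (suc x) (at x b idle (lookup L j)) (read (val (suc j))) (at? x b marked (clauseAt L (suc j)))
    ask     : Rule zero ask (read (tok (fromℕ n) true)) choose
    choose  : ∀ j → Rule zero choose (write (val (suc j))) release
    release : Rule zero release (write (tok zero false)) ask

  data Effect : Op Value → Value → Value → Set where
    read  : ∀ {v}   → Effect (read v) v v
    write : ∀ {u v} → Effect (write v) u v

  SatisfiedBy : (Fin n → Bool) → List (Literal n) → Set
  SatisfiedBy α C = ∃[ x ] member (x , α x) C ≡ true

  member-sat : ∀ (x : Fin n) b C → sat b (member (x , true) C) (member (x , false) C) ≡ member (x , b) C
  member-sat x true  C = refl
  member-sat x false C = refl

  clauseAt-just : ∀ L k {C} → clauseAt L k ≡ just C → ∃[ i ] toℕ i ≡ toℕ k × lookup L i ≡ C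
  clauseAt-just (D ∷ L) zero    refl = zero , refl , refl
  clauseAt-just (D ∷ L) (suc k) eq with clauseAt-just L k eq
  ... | i , i≡k , L-i≡C = suc i , cong suc i≡k , L-i≡C

  clauseAt-lookup : ∀ L i → clauseAt L (inject₁ i) ≡ just (lookup L i)
  clauseAt-lookup (C ∷ L) zero    = refl
  clauseAt-lookup (C ∷ L) (suc i) = clauseAt-lookup L i

  clauseAt-end : ∀ L → clauseAt L (fromℕ (length L)) ≡ nothing
  clauseAt-end []      = refl
  clauseAt-end (C ∷ L) = clauseAt-end L

  -- Soundness: an invariant of all computations

  module Soundness
    (distinct : ∀ i j → (∀ x b → member (x , b) (lookup L i) ≡ member (x , b) (lookup L j)) → i ≡ j)
    where

    -- hop i j: the threads are to leave clause i, and the controller has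
    -- written val (suc j), which is as it should be only if i = j.
    data Hop : Set where
      start : Hop
      hop   : (i j : Fin m) → Hop

    target : Hop → Fin (suc m)
    target start     = zero
    target (hop i j) = suc j

    SatisfiedUpTo : (Fin n → Bool) → Fin m → Set
    SatisfiedUpTo α i = ∀ h → toℕ h ≤ toℕ i → SatisfiedBy α (lookup L h)

    Done : (Fin n → Bool) → Hop → Set
    Done α start     = ⊤
    Done α (hop i j) = SatisfiedUpTo α i

    -- This is what a single move of thread x reveals. Collected over all x, it makes clauses i and
    -- j equal as sets of literals.
    Match : Hop → Fin n → Set
    Match start     x = ⊤
    Match (hop i j) x = ∀ b → member (x , b) (lookup L i) ≡ member (x , b) (lookup L j)

    Unread : Hop → Bool → Fin n → State → Set
    Unread start     b x s = s ≡ init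
    Unread (hop i j) b x s = s ≡ at x b idle (lookup L i)

    Moved : Phase → Hop → Bool → Fin n → State → Set
    Moved φ H b x s = Match H x × s ≡ at? x b φ (clauseAt L (target H))

    Pending : Hop → Bool → Fin n → State → Set
    Pending H b x s = Unread H b x s ⊎ Moved marked H b x s

    Hit : (Fin n → Bool) → Hop → Set
    Hit α H = ∃[ C ] clauseAt L (target H) ≡ just C × SatisfiedBy α C

    -- The constructors are the stations of a round: threads follow the announced number; the token
    -- is on its way to y; thread y has read the token, which the memory still shows; the controller
    -- has accepted it. A thread that stays behind is covered by `Pending`, whereas threads already
    -- visited satisfy `Moved idle`. The hop is resolved to a single verified clause only at the
    -- last station.
    data Invariant (st : Fin (suc n) → State) (μ : Value) : Set where
      reading    : ∀ α H → Done α H → μ ≡ val (target H) → st zero ≡ release →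
                   (∀ x → Pending H (α x) x (st (suc x))) → Invariant st μ
      collecting : ∀ α H y s → Done α H → μ ≡ tok y s → st zero ≡ ask →
                   (∀ x → toℕ x < toℕ y → Moved idle H (α x) x (st (suc x))) →
                   (∀ x → toℕ y ≤ toℕ x → Pending H (α x) x (st (suc x))) →
                   (s ≡ true → Hit α H) → Invariant st μ
      passing    : ∀ α H y s s′ → Done α H → μ ≡ tok (inject₁ y) s → st zero ≡ ask →
                   (∀ x → toℕ x < toℕ y → Moved idle H (α x) x (st (suc x))) →
                   Moved (pass s′) H (α y) y (st (suc y)) →
                   (∀ x → toℕ y < toℕ x → Pending H (α x) x (st (suc x))) →
                   (s′ ≡ true → Hit α H) → Invariant st μ
      verified   : ∀ α i → SatisfiedUpTo α i → μ ≡ tok (fromℕ n) true → st zero ≡ choose →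
                   (∀ x → st (suc x) ≡ at x (α x) idle (lookup L i)) → Invariant st μ

    at?-inv : ∀ {x b φ c p q ψ} mC → at? x b φ mC ≡ act c p q ψ →
      ∃[ C ] mC ≡ just C × act c p q ψ ≡ at x b φ C
    at?-inv (just C) refl = C , refl , refl

    moved-passes : ∀ {H b x s φ ψ c p q} → s ≡ act c p q φ → Moved φ H b x s →
      Moved ψ H b x (act c p q ψ)
    moved-passes {H} refl (match , eq) with at?-inv (clauseAt L (target H)) (sym eq)
    ... | C , C-eq , refl rewrite C-eq = match , refl

    phase-unique : ∀ {H b x s φ ψ c p q} → s ≡ act c p q φ → Moved ψ H b x s → φ ≡ ψ
    phase-unique {H} refl (_ , eq) with at?-inv (clauseAt L (target H)) (sym eq)
    ... | C , _ , refl = refl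

    pending-marked : ∀ {H b x s c p q} → s ≡ act c p q marked → Pending H b x s → Moved marked H b x s
    pending-marked {start}   refl (inj₁ ())
    pending-marked {hop i j} refl (inj₁ ())
    pending-marked           eq   (inj₂ moved) = moved

    pending-pass : ∀ {H b x s t c p q} → s ≡ act c p q (pass t) → ¬ Pending H b x s
    pending-pass {start}   refl (inj₁ ())
    pending-pass {hop i j} refl (inj₁ ())
    pending-pass           eq   (inj₂ moved) with phase-unique eq moved
    ... | ()

    hit-by : ∀ {α H x s φ c p q} → s ≡ act c p q φ → Moved φ H (α x) x s → sat c p q ≡ true → Hit α H
    hit-by {α} {H} {x} refl (_ , eq) sat≡ with at?-inv (clauseAt L (target H)) (sym eq)
    ... | C , C-eq , refl = C , C-eq , x , trans (sym (member-sat x (α x) C)) sat≡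

    at-injective : ∀ {b c p q p′ q′ φ ψ} → act b p q φ ≡ act c p′ q′ ψ → b ≡ c × p ≡ p′ × q ≡ q′
    at-injective refl = refl , refl , refl

    tok-injective : ∀ {y z s t} → tok y s ≡ tok z t → y ≡ z × s ≡ t
    tok-injective refl = refl , refl

    val-injective : ∀ {j k} → val j ≡ val k → j ≡ k
    val-injective refl = refl

    update : Fin n → Bool → (Fin n → Bool) → Fin n → Bool
    update x b α y with y ≟ x
    ... | yes _ = b
    ... | no  _ = α y

    -- The announced clause is satisfied by the hit. The earlier ones are covered by `Done` provided
    -- that the announced clause is the successor of the one left, which is what the matches ensure.
    verify : ∀ α H → Done α H → (∀ x → Match H x) → Hit α H →
      ∃[ i ] SatisfiedUpTo α i × clauseAt L (target H) ≡ just (lookup L i)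
    verify α H done match (C , C-eq , hit) with clauseAt-just L (target H) C-eq
    ... | i , i≡target , refl = i , up-to H done match i≡target , C-eq
      where
      last-or-before : ∀ h → toℕ h ≤ toℕ i → toℕ h ≡ toℕ i ⊎ toℕ h < toℕ i
      last-or-before h h≤i = swap (m≤n⇒m<n∨m≡n h≤i)
      at-i : ∀ {h} → toℕ h ≡ toℕ i → SatisfiedBy α (lookup L h)
      at-i h≡i = subst (λ h → SatisfiedBy α (lookup L h)) (sym (toℕ-injective h≡i)) hit
      up-to : ∀ H → Done α H → (∀ x → Match H x) → toℕ i ≡ toℕ (target H) → SatisfiedUpTo α i
      up-to start     _    _     i≡0 h h≤i = at-i (trans (n≤0⇒n≡0 (subst (toℕ h ≤_) i≡0 h≤i)) (sym i≡0))
      up-to (hop j k) done match i≡k h h≤i with last-or-before h h≤i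
      ... | inj₁ h≡i = at-i h≡i
      -- The guess is exposed as correct: no two positions carry the same set of literals.
      ... | inj₂ h<i with distinct j k match
      ...   | refl = done h (≤-pred (subst (toℕ h <_) i≡k h<i))

    -- Each station admits only one or two kinds of rules; every other rule contradicts the memory
    -- value, the state of the controller or the phase of the thread.
    invariant-step : ∀ {i s o s′ st st′ μ μ′} → Rule i s o s′ → Effect o μ μ′ → s ≡ st i → st′ i ≡ s′ →
      (∀ j → j ≢ i → st′ j ≡ st j) → Invariant st μ → Invariant st′ μ′
    invariant-step (take x b p q s) read s≡ st′≡ same (reading α H done () ctl pending)
    invariant-step (put x b p q s) write s≡ st′≡ same (reading α H done μ≡ ctl pending) =
      ⊥-elim (pending-pass (sym s≡) (pending x))
    invariant-step {st′ = st′} (enter x b) read s≡ st′≡ same (reading α start done μ≡ ctl pending) =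
      -- Before thread x has entered, `α x` is a dummy value; it is now set to the guess. No clause
      -- has been verified under α yet, so the change is harmless.
      reading (update x b α) start tt μ≡ (trans (same zero λ ()) ctl) pending′
      where
      pending′ : ∀ y → Pending start (update x b α y) y (st′ (suc y))
      pending′ y with y ≟ x
      ... | yes refl = inj₂ (tt , st′≡)
      ... | no y≢x   = subst (Pending start (α y) y) (sym (same (suc y) (y≢x ∘ suc-injective))) (pending y)
    invariant-step (enter x b) read s≡ st′≡ same (reading α (hop i j) done () ctl pending)
    invariant-step (move x b j) read s≡ st′≡ same (reading α start done () ctl pending)
    invariant-step {st′ = st′} (move x b j) read s≡ st′≡ same (reading α (hop i j) done refl ctl pending) =
      reading α (hop i j) done refl (trans (same zero λ ()) ctl) pending′
      where
      matching : ∀ {s} → at x b idle (lookup L j) ≡ s → Pending (hop i j) (α x) x s → b ≡ α x × Match (hop i j) x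
      matching eq   (inj₂ moved) with phase-unique (sym eq) moved
      ... | ()
      -- The thread leaves clause i by a rule for clause j, so both assign it the same state: the
      -- same truth value and the same two membership bits.
      matching refl (inj₁ unread) with at-injective unread
      ... | b≡ , p≡ , q≡ = b≡ , λ { true → sym p≡ ; false → sym q≡ }
      pending′ : ∀ y → Pending (hop i j) (α y) y (st′ (suc y))
      pending′ y with y ≟ x
      ... | no y≢x   = subst (Pending (hop i j) (α y) y) (sym (same (suc y) (y≢x ∘ suc-injective))) (pending y)
      ... | yes refl with matching s≡ (pending y)
      ...   | refl , match = inj₂ (match , st′≡)
    invariant-step ask _ s≡ st′≡ same (reading α H done μ≡ ctl pending) with () ← trans s≡ ctl
    invariant-step (choose j) _ s≡ st′≡ same (reading α H done μ≡ ctl pending) with () ← trans s≡ ctl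
    invariant-step release write s≡ st′≡ same (reading α H done μ≡ ctl pending) =
      collecting α H zero false done refl st′≡ (λ _ ())
        (λ x _ → subst (Pending H (α x) x) (sym (same (suc x) λ ())) (pending x)) (λ ())

    invariant-step {st′ = st′} (take x b p q s) read s≡ st′≡ same (collecting α H y s done refl ctl moved pending hit) =
      passing α H x s (s ∨ sat b p q) done refl (trans (same zero λ ()) ctl)
        (λ z z<x → subst (Moved idle H (α z) z) (sym (same (suc z) λ { refl → <-irrefl refl z<x }))
          (moved z (subst (toℕ z <_) (sym (toℕ-inject₁ x)) z<x)))
        (subst (Moved (pass _) H (α x) x) (sym st′≡) (moved-passes (sym s≡) moved-x))
        (λ z x<z → subst (Pending H (α z) z) (sym (same (suc z) λ { refl → <-irrefl refl x<z }))
          (pending z (subst (_≤ toℕ z) (sym (toℕ-inject₁ x)) (<⇒≤ x<z))))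
        (hit′ s hit)
      where
      moved-x : Moved marked H (α x) x _
      -- The token is taken only in phase `marked`, so x has not stayed behind.
      moved-x = pending-marked (sym s≡) (pending x (≤-reflexive (toℕ-inject₁ x)))
      hit′ : ∀ s → (s ≡ true → Hit α H) → s ∨ sat b p q ≡ true → Hit α H
      hit′ true  hit _    = hit refl
      hit′ false hit sat≡ = hit-by {α} (sym s≡) moved-x sat≡
    invariant-step (put x b p q s) write s≡ st′≡ same (collecting α H y t done μ≡ ctl moved pending hit)
      with toℕ x <? toℕ y
    ... | no x≮y = ⊥-elim (pending-pass (sym s≡) (pending x (≮⇒≥ x≮y)))
    ... | yes x<y with () ← phase-unique (sym s≡) (moved x x<y)
    invariant-step (enter x b) read s≡ st′≡ same (collecting α H y s done () ctl moved pending hit)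
    invariant-step (move x b j) read s≡ st′≡ same (collecting α H y s done () ctl moved pending hit)
    invariant-step ask read s≡ st′≡ same (collecting α H y s done refl ctl moved pending hit)
      -- Here y is `fromℕ n` and the flag is `true`: all threads have moved, and one of them
      -- satisfies the clause.
      with verify α H done (λ x → proj₁ (moved x (x<n x))) (hit refl)
      where
      x<n : ∀ (x : Fin n) → toℕ x < toℕ (fromℕ n)
      x<n x = subst (toℕ x <_) (sym (toℕ-fromℕ n)) (toℕ<n x)
    ... | i , up-to , C-eq = verified α i up-to refl st′≡
      λ x → trans (same (suc x) λ ()) (trans (proj₂ (moved x (subst (toℕ x <_) (sym (toℕ-fromℕ n)) (toℕ<n x))))
        (cong (at? x (α x) idle) C-eq))
    invariant-step (choose j) _ s≡ st′≡ same (collecting α H y s done μ≡ ctl moved pending hit) with () ← trans s≡ ctl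
    invariant-step release _ s≡ st′≡ same (collecting α H y s done μ≡ ctl moved pending hit) with () ← trans s≡ ctl

    invariant-step (take x b p q s) read s≡ st′≡ same (passing α H y t t′ done μ≡ ctl moved moved-y pending hit)
      with refl ← inject₁-injective (proj₁ (tok-injective μ≡))
      with () ← phase-unique (sym s≡) moved-y
    invariant-step (put x b p q s) write s≡ st′≡ same (passing α H y t t′ done μ≡ ctl moved moved-y pending hit)
      with <-cmp (toℕ x) (toℕ y)
    ... | tri< x<y _ _ with () ← phase-unique (sym s≡) (moved x x<y)
    ... | tri> _ _ y<x = ⊥-elim (pending-pass (sym s≡) (pending x y<x))
    ... | tri≈ _ x≡y _ with refl ← toℕ-injective x≡y with refl ← phase-unique (sym s≡) moved-y =
      collecting α H (suc x) s done refl (trans (same zero λ ()) ctl) moved′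
        (λ z x<z → subst (Pending H (α z) z) (sym (same (suc z) λ { refl → <-irrefl refl x<z })) (pending z x<z))
        hit
      where
      moved′ : ∀ z → toℕ z < suc (toℕ x) → Moved idle H (α z) z _
      moved′ z (s≤s z≤x) with m≤n⇒m<n∨m≡n z≤x
      ... | inj₁ z<x = subst (Moved idle H (α z) z) (sym (same (suc z) λ { refl → <-irrefl refl z<x })) (moved z z<x)
      ... | inj₂ z≡x with refl ← toℕ-injective z≡x =
        subst (Moved idle H (α z) z) (sym st′≡) (moved-passes (sym s≡) moved-y)
    invariant-step (enter x b) read s≡ st′≡ same (passing α H y s s′ done () ctl moved moved-y pending hit)
    invariant-step (move x b j) read s≡ st′≡ same (passing α H y s s′ done () ctl moved moved-y pending hit)
    invariant-step ask read s≡ st′≡ same (passing α H y s s′ done μ≡ ctl moved moved-y pending hit) =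
      ⊥-elim (fromℕ≢inject₁ (proj₁ (tok-injective μ≡)))
    invariant-step (choose j) _ s≡ st′≡ same (passing α H y s s′ done μ≡ ctl moved moved-y pending hit) with () ← trans s≡ ctl
    invariant-step release _ s≡ st′≡ same (passing α H y s s′ done μ≡ ctl moved moved-y pending hit) with () ← trans s≡ ctl

    invariant-step (take x b p q s) _ s≡ st′≡ same (verified α i up-to μ≡ ctl idles) with () ← trans s≡ (idles x)
    invariant-step (put x b p q s) _ s≡ st′≡ same (verified α i up-to μ≡ ctl idles) with () ← trans s≡ (idles x)
    invariant-step (enter x b) _ s≡ st′≡ same (verified α i up-to μ≡ ctl idles) with () ← trans s≡ (idles x)
    invariant-step (move x b j) read s≡ st′≡ same (verified α i up-to () ctl idles)
    invariant-step ask _ s≡ st′≡ same (verified α i up-to μ≡ ctl idles) with () ← trans s≡ ctl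
    invariant-step (choose j) write s≡ st′≡ same (verified α i up-to μ≡ ctl idles) =
      reading α (hop i j) up-to refl st′≡ (λ x → inj₁ (trans (same (suc x) λ ()) (idles x)))
    invariant-step release _ s≡ st′≡ same (verified α i up-to μ≡ ctl idles) with () ← trans s≡ ctl

    invariant-init : ∀ {st} → st zero ≡ release → (∀ x → st (suc x) ≡ init) → Invariant st (val zero)
    invariant-init ctl inits = reading (λ _ → false) start tt refl ctl (λ x → inj₁ (inits x))

    -- The value `val m` either is the initial one, in which case there are no clauses, or was
    -- announced on leaving a clause i. All threads are at `end`, so all have moved, which makes i
    -- the last clause.
    invariant-final : ∀ {st} → Invariant st (val (fromℕ m)) → (∀ x → st (suc x) ≡ end) →
      ∃[ α ] ∀ i → SatisfiedBy α (lookup L i)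
    invariant-final (reading α start done μ≡ ctl pending) ends = α , λ i → ⊥-elim (no-clause i (val-injective μ≡))
      where
      no-clause : ∀ {k} (i : Fin k) → fromℕ k ≢ zero
      no-clause {suc k} i ()
    invariant-final (reading α (hop i j) done μ≡ ctl pending) ends with distinct i j match
      where
      matching : ∀ x {s} → s ≡ end → Pending (hop i j) (α x) x s → Match (hop i j) x
      matching x refl (inj₁ ())
      matching x refl (inj₂ (match , _)) = match
      match : ∀ x → Match (hop i j) x
      match x = matching x (ends x) (pending x)
    ... | refl = α , λ h → done h (≤-pred (≤-trans (toℕ<n h) (≤-reflexive (trans (sym (toℕ-fromℕ m)) (cong toℕ (val-injective μ≡))))))

  -- The concrete program

  Transition : Set
  Transition = State × Op Value × State

  tokenRulesAt : Fin n → Bool × Bool × Bool × Bool → List Transition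
  tokenRulesAt x (b , p , q , s) =
    (act b p q marked , read (tok (inject₁ x) s) , act b p q (pass (s ∨ sat b p q))) ∷
    (act b p q (pass s) , write (tok (suc x) s) , act b p q idle) ∷ []

  enterRule : Fin n → Bool → Transition
  enterRule x b = init , read (val zero) , at? x b marked (clauseAt L zero)

  moveRule : Fin n → Fin m → Bool → Transition
  moveRule x j b = at x b idle (lookup L j) , read (val (suc j)) , at? x b marked (clauseAt L (suc j))

  tokenRules enterRules moveRules : Fin n → List Transition
  tokenRules x = concatMap (tokenRulesAt x) quadruples
  enterRules x = map (enterRule x) booleans
  moveRules x  = concat (tabulate λ j → map (moveRule x j) booleans)

  rules : Fin (suc n) → List Transition
  rules zero    = (ask , read (tok (fromℕ n) true) , choose) ∷ (release , write (tok zero false) , ask) ∷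
                  tabulate (λ j → choose , write (val (suc j)) , release)
  rules (suc x) = tokenRules x ++ enterRules x ++ moveRules x

  rules-sound : ∀ i {s o s′} → (s , o , s′) ∈ rules i → Rule i s o s′
  rules-sound zero (here refl)         = ask
  rules-sound zero (there (here refl)) = release
  rules-sound zero (there (there r)) with ∈-tabulate⁻ r
  ... | j , refl = choose j
  rules-sound (suc x) r = [ from-token , [ from-enter , from-move ]′ ∘ ∈-++⁻ (enterRules x) ]′ (∈-++⁻ (tokenRules x) r)
    where
    from-token : ∀ {s o s′} → (s , o , s′) ∈ tokenRules x → Rule (suc x) s o s′
    from-token r with satisfied (∈-concatMap⁻ (tokenRulesAt x) {xs = quadruples} r)
    ... | (b , p , q , s) , here refl         = take x b p q s
    ... | (b , p , q , s) , there (here refl) = put x b p q s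
    from-enter : ∀ {s o s′} → (s , o , s′) ∈ enterRules x → Rule (suc x) s o s′
    from-enter r with ∈-map⁻ (enterRule x) r
    ... | b , _ , refl = enter x b
    from-move : ∀ {s o s′} → (s , o , s′) ∈ moveRules x → Rule (suc x) s o s′
    from-move r with ∈-concat⁻′ (tabulate λ j → map (moveRule x j) booleans) r
    ... | _ , r∈ , ∈rs with ∈-tabulate⁻ {f = λ j → map (moveRule x j) booleans} ∈rs
    ...   | j , refl with ∈-map⁻ (moveRule x j) r∈
    ...     | b , _ , refl = move x b j

  rules-complete : ∀ {i s o s′} → Rule i s o s′ → (s , o , s′) ∈ rules i
  rules-complete (take x b p q s) =
    ∈-++⁺ˡ (∈-concatMap⁺ (tokenRulesAt x) (lose (∈-quadruples b p q s) (here refl)))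
  rules-complete (put x b p q s)  =
    ∈-++⁺ˡ (∈-concatMap⁺ (tokenRulesAt x) (lose (∈-quadruples b p q s) (there (here refl))))
  rules-complete (enter x b)      =
    ∈-++⁺ʳ (tokenRules x) (∈-++⁺ˡ (∈-map⁺ (enterRule x) (∈-booleans b)))
  rules-complete (move x b j)     =
    ∈-++⁺ʳ (tokenRules x) (∈-++⁺ʳ (enterRules x)
      (∈-concat⁺′ (∈-map⁺ (moveRule x j) (∈-booleans b)) (∈-tabulate⁺ j)))
  rules-complete ask              = here refl
  rules-complete (choose j)       = there (there (∈-tabulate⁺ j))
  rules-complete release          = there (here refl)

  domain : ℕ
  domain = (suc n + suc n) + suc m

  ⌊_⌋ᵛ : Value → Fin domain
  ⌊ tok y false ⌋ᵛ = (y ↑ˡ suc n) ↑ˡ suc m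
  ⌊ tok y true ⌋ᵛ  = (suc n ↑ʳ y) ↑ˡ suc m
  ⌊ val k ⌋ᵛ       = (suc n + suc n) ↑ʳ k

  value : Fin domain → Value
  value d = [ (λ e → [ (λ y → tok y false) , (λ y → tok y true) ]′ (splitAt (suc n) e)) , val ]′ (splitAt (suc n + suc n) d)

  value-⌊⌋ᵛ : ∀ v → value ⌊ v ⌋ᵛ ≡ v
  value-⌊⌋ᵛ (tok y false)
    rewrite splitAt-↑ˡ (suc n + suc n) (y ↑ˡ suc n) (suc m) | splitAt-↑ˡ (suc n) y (suc n) = refl
  value-⌊⌋ᵛ (tok y true)
    rewrite splitAt-↑ˡ (suc n + suc n) (suc n ↑ʳ y) (suc m) | splitAt-↑ʳ (suc n) (suc n) y = refl
  value-⌊⌋ᵛ (val k) rewrite splitAt-↑ʳ (suc n + suc n) (suc m) k = refl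

  ⌊⌋ᵛ-injective : ∀ {u v} → ⌊ u ⌋ᵛ ≡ ⌊ v ⌋ᵛ → u ≡ v
  ⌊⌋ᵛ-injective {u} {v} eq = trans (sym (value-⌊⌋ᵛ u)) (trans (cong value eq) (value-⌊⌋ᵛ v))

  ⌊_⌋ᵒ : Op Value → Op (Fin domain)
  ⌊ read v ⌋ᵒ  = read ⌊ v ⌋ᵛ
  ⌊ write v ⌋ᵒ = write ⌊ v ⌋ᵛ

  ⌊_⌋ᵗ : Transition → Fin 37 × Label (Fin domain) × Fin 37
  ⌊ s , o , s′ ⌋ᵗ = ⌊ s ⌋ˢ , just ⌊ o ⌋ᵒ , ⌊ s′ ⌋ˢ

  _▸_ : State → (Fin n → State) → Fin (suc n) → State
  (s ▸ st) zero    = s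
  (s ▸ st) (suc x) = st x

  program : Program
  program = record
    { domain  = domain
    ; a⁰      = ⌊ val zero ⌋ᵛ
    ; t       = suc n
    ; threads = λ i → record { states = 37 ; q⁰ = ⌊ (release ▸ λ _ → init) i ⌋ˢ ; δ = map ⌊_⌋ᵗ (rules i) }
    }

  open Semantics program

  ⌊_∥_⌋ : (Fin (suc n) → State) → Value → Config
  ⌊ st ∥ μ ⌋ = (λ i → ⌊ st i ⌋ˢ) , ⌊ μ ⌋ᵛ

  final : Config
  final = ⌊ release ▸ (λ _ → end) ∥ val (fromℕ m) ⌋

  read-injective : ∀ {a b : Fin domain} → just (read a) ≡ just (read b) → a ≡ b
  read-injective refl = refl

  -- The label is a variable with an equation, so that matching on `Memory` does not force
  -- unification to invert `⌊_⌋ᵛ`.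
  effect : ∀ {ℓ μ a} o → ℓ ≡ just ⌊ o ⌋ᵒ → Memory ℓ ⌊ μ ⌋ᵛ a → ∃[ μ′ ] a ≡ ⌊ μ′ ⌋ᵛ × Effect o μ μ′
  effect {μ = μ} (read v) eq read with refl ← ⌊⌋ᵛ-injective {μ} {v} (read-injective eq) = v , refl , read
  effect (write v) refl write = v , refl , write

  record View (c : Config) (st : Fin (suc n) → State) (μ : Value) : Set where
    field
      states : ∀ i → pc c i ≡ ⌊ st i ⌋ˢ
      memory : mem c ≡ ⌊ μ ⌋ᵛ

  module _
    (distinct : ∀ i j → (∀ x b → member (x , b) (lookup L i) ≡ member (x , b) (lookup L j)) → i ≡ j)
    where
    open Soundness distinct

    Sound : Config → Set
    Sound c = ∃[ st ] ∃[ μ ] View c st μ × Invariant st μ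

    step-sound : ∀ {i ℓ c c′} → Step i ℓ c c′ → Sound c → Sound c′
    step-sound {i} {c = c} {c′} step (st , μ , view , inv) with ∈-map⁻ ⌊_⌋ᵗ (Step.transition step)
    ... | (s , o , s′) , r , eq with ,-injective eq
    ...   | pc≡ , eq′ with ,-injective eq′
    ...     | refl , pc′≡ with effect o refl (subst (λ a → Memory _ a (mem c′)) (View.memory view) (Step.memory step))
    ...       | μ′ , mem≡ , eff = st′ , μ′ , record { states = states′ ; memory = mem≡ } ,
      invariant-step (rules-sound i r) eff s≡ st′-i st′-j inv
      where
      s≡ : s ≡ st i
      s≡ = ⌊⌋ˢ-injective s (st i) (trans (sym pc≡) (View.states view i))
      st′ : Fin (suc n) → State
      st′ = updateAt st i (λ _ → s′)
      st′-i : st′ i ≡ s′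
      st′-i = updateAt-updates i st
      st′-j : ∀ j → j ≢ i → st′ j ≡ st j
      st′-j j j≢i = updateAt-minimal j i st j≢i
      states′ : ∀ j → pc c′ j ≡ ⌊ st′ j ⌋ˢ
      states′ j with j ≟ i
      ... | yes refl = trans pc′≡ (cong ⌊_⌋ˢ (sym st′-i))
      ... | no j≢i   = trans (Step.others step j j≢i) (trans (View.states view j) (cong ⌊_⌋ˢ (sym (st′-j j j≢i))))

    stage-sound : ∀ {w c c′} → Star (StageStep w) c c′ → Sound c → Sound c′
    stage-sound Star.ε                        sound = sound
    stage-sound ((_ , _ , step , _) Star.◅ r) sound = stage-sound r (step-sound step sound)

    staged-sound : ∀ {k c c′} → StagedComputation k c c′ → Sound c → Sound c′
    staged-sound []               sound = sound
    staged-sound ((_ , r) ∷ rest) sound = staged-sound rest (stage-sound r sound)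

    sound : ∀ {k c} → c ≈ final → StagedComputation k c⁰ c → ∃[ α ] ∀ i → SatisfiedBy α (lookup L i)
    sound (pc≡ , mem≡) comp
      with staged-sound comp (release ▸ (λ _ → init) , val zero , record { states = λ _ → refl ; memory = refl } ,
                              invariant-init refl (λ _ → refl))
    ... | st , μ , view , inv
      with refl ← ⌊⌋ᵛ-injective {μ} {val (fromℕ m)} (trans (sym (View.memory view)) mem≡) =
      invariant-final inv (λ x → ⌊⌋ˢ-injective _ end (trans (sym (View.states view (suc x))) (pc≡ (suc x))))

  -- Completeness: the run for a satisfying assignment

  _++ˢ_ : ∀ {j k c c′ c″} → StagedComputation j c c′ → StagedComputation k c′ c″ → StagedComputation (j + k) c c″
  []       ++ˢ s = s
  (r ∷ rs) ++ˢ s = r ∷ (rs ++ˢ s)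

  -- The number of stages is exact, so a short run is padded with empty stages.
  idling : ∀ k {c} → StagedComputation k c c
  idling zero    = []
  idling (suc k) = (zero , Star.ε) ∷ idling k

  -- States are functions, so configurations can be tracked only pointwise.
  Reach : ℕ → (Fin (suc n) → State) → Value → (Fin (suc n) → State) → Value → Set
  Reach k st μ st′ μ′ = ∀ {c} → View c st μ → ∃[ c′ ] View c′ st′ μ′ × StagedComputation k c c′

  infixr 5 _∙∙_
  _∙∙_ : ∀ {j k st st′ st″ μ μ′ μ″} → Reach j st μ st′ μ′ → Reach k st′ μ′ st″ μ″ → Reach (j + k) st μ st″ μ″
  (r ∙∙ s) view with r view
  ... | _ , view′ , comp with s view′
  ...   | c″ , view″ , comp′ = c″ , view″ , comp ++ˢ comp′

  view-≗ : ∀ {c st st₁ μ} → (∀ x → st x ≡ st₁ x) → View c st μ → View c st₁ μ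
  view-≗ eq view = record
    { states = λ i → trans (View.states view i) (cong ⌊_⌋ˢ (eq i)) ; memory = View.memory view }

  reach-≗ : ∀ {k st st₁ st′ st₁′ μ μ′} → (∀ x → st x ≡ st₁ x) → (∀ x → st′ x ≡ st₁′ x) →
    Reach k st₁ μ st′ μ′ → Reach k st μ st₁′ μ′
  reach-≗ eq eq′ r view
    with c′ , view′ , comp ← r (view-≗ eq view) = c′ , view-≗ eq′ view′ , comp

  effect-memory : ∀ {o μ μ′} → Effect o μ μ′ → Memory (just ⌊ o ⌋ᵒ) ⌊ μ ⌋ᵛ ⌊ μ′ ⌋ᵛ
  effect-memory read  = read
  effect-memory write = write

  -- Every step is a stage of its own, with the acting thread as the designated writer; counting
  -- stages thus amounts to counting steps.
  reach-step : ∀ {i s o s′ st st′ μ μ′} → Rule i s o s′ → Effect o μ μ′ → st i ≡ s → st′ i ≡ s′ →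
    (∀ j → j ≢ i → st′ j ≡ st j) → Reach 1 st μ st′ μ′
  reach-step {i} {s} {o} {s′} {st} {st′} {μ} {μ′} r eff st-i st′-i same {c} view =
    ⌊ st′ ∥ μ′ ⌋ , record { states = λ _ → refl ; memory = refl } ,
    (i , (i , _ , step , λ _ _ → refl) Star.◅ Star.ε) ∷ []
    where
    step : Step i (just ⌊ o ⌋ᵒ) c ⌊ st′ ∥ μ′ ⌋
    step = record
      { transition = subst₂ (λ q q′ → (q , just ⌊ o ⌋ᵒ , q′) ∈ map ⌊_⌋ᵗ (rules i))
          (trans (cong ⌊_⌋ˢ (sym st-i)) (sym (View.states view i))) (cong ⌊_⌋ˢ (sym st′-i))
          (∈-map⁺ ⌊_⌋ᵗ (rules-complete r))
      ; memory = subst (λ a → Memory _ a _) (sym (View.memory view)) (effect-memory eff)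
      ; others = λ j j≢i → trans (cong ⌊_⌋ˢ (same j j≢i)) (sym (View.states view j))
      }

  upTo : ℕ → (Fin n → State) → (Fin n → State) → Fin n → State
  upTo r new old x with toℕ x <? r
  ... | yes _ = new x
  ... | no  _ = old x

  upTo-< : ∀ {r new old x} → toℕ x < r → upTo r new old x ≡ new x
  upTo-< {r} {x = x} x<r with toℕ x <? r
  ... | yes _   = refl
  ... | no  x≮r = ⊥-elim (x≮r x<r)

  upTo-≥ : ∀ {r new old x} → r ≤ toℕ x → upTo r new old x ≡ old x
  upTo-≥ {r} {x = x} r≤x with toℕ x <? r
  ... | yes x<r = ⊥-elim (<⇒≱ x<r r≤x)
  ... | no  _   = refl

  ▸-cong : ∀ {s st st′} → (∀ x → st x ≡ st′ x) → ∀ i → (s ▸ st) i ≡ (s ▸ st′) i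
  ▸-cong eq zero    = refl
  ▸-cong eq (suc x) = eq x

  -- Common form of the three passes over all threads: entering, handing on the token, and moving.
  -- The memory value may depend on the progress, which only the token needs. Intermediate
  -- configurations are described by `upTo`.
  sweep : ∀ {s} (old new : Fin n → State) (μ : Fin (suc n) → Value) k →
    (∀ y {st st′} → st (suc y) ≡ old y → st′ (suc y) ≡ new y → (∀ i → i ≢ suc y → st′ i ≡ st i) →
      Reach k st (μ (inject₁ y)) st′ (μ (suc y))) →
    Reach (n * k) (s ▸ old) (μ zero) (s ▸ new) (μ (fromℕ n))
  sweep {s} old new μ k move-one = reach-≗ (λ _ → refl)
    (▸-cong λ x → upTo-< {toℕ (fromℕ n)} {new} {old} (subst (toℕ x <_) (sym (toℕ-fromℕ n)) (toℕ<n x)))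
    (subst (λ r → Reach (r * k) (s ▸ old) (μ zero) (s ▸ upTo (toℕ (fromℕ n)) new old) (μ (fromℕ n))) (toℕ-fromℕ n)
      (<-weakInduction (λ r → Reach (toℕ r * k) (s ▸ old) (μ zero) (s ▸ upTo (toℕ r) new old) (μ r)) first next (fromℕ n)))
    where
    first : Reach 0 (s ▸ old) (μ zero) (s ▸ upTo 0 new old) (μ zero)
    first = reach-≗ (λ _ → refl) (▸-cong λ x → sym (upTo-≥ {0} {new} {old} {x} z≤n)) (λ view → _ , view , [])
    next : ∀ y → Reach (toℕ (inject₁ y) * k) (s ▸ old) (μ zero) (s ▸ upTo (toℕ (inject₁ y)) new old) (μ (inject₁ y)) →
      Reach (k + toℕ y * k) (s ▸ old) (μ zero) (s ▸ upTo (suc (toℕ y)) new old) (μ (suc y))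
    next y r rewrite toℕ-inject₁ y | +-comm k (toℕ y * k) =
      r ∙∙ move-one y (upTo-≥ {toℕ y} ≤-refl) (upTo-< {suc (toℕ y)} ≤-refl) same
      where
      same : ∀ i → i ≢ suc y → (s ▸ upTo (suc (toℕ y)) new old) i ≡ (s ▸ upTo (toℕ y) new old) i
      same zero    _     = refl
      same (suc x) x≢y with <-cmp (toℕ x) (toℕ y)
      ... | tri< x<y _ _ = trans (upTo-< {suc (toℕ y)} (m<n⇒m<1+n x<y)) (sym (upTo-< {toℕ y} x<y))
      ... | tri≈ _ x≡y _ = ⊥-elim (x≢y (cong suc (toℕ-injective x≡y)))
      ... | tri> _ _ y<x = trans (upTo-≥ {suc (toℕ y)} y<x) (sym (upTo-≥ {toℕ y} (<⇒≤ y<x)))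

  -- The flag of the token when it is about to reach the given thread.
  any-before : ∀ {n} → (Fin n → Bool) → Fin (suc n) → Bool
  any-before             f zero    = false
  any-before {n = suc _} f (suc x) = f zero ∨ any-before (f ∘ suc) x

  any-before-suc : ∀ {n} (f : Fin n → Bool) x → any-before f (suc x) ≡ any-before f (inject₁ x) ∨ f x
  any-before-suc f zero    = ∨-identityʳ (f zero)
  any-before-suc f (suc x) = trans (cong (f zero ∨_) (any-before-suc (f ∘ suc) x)) (sym (∨-assoc (f zero) _ _))

  any-before-end : ∀ {n} (f : Fin n → Bool) x → f x ≡ true → any-before f (fromℕ n) ≡ true
  any-before-end f zero    fx≡ = cong (_∨ any-before (f ∘ suc) (fromℕ _)) fx≡
  any-before-end f (suc x) fx≡ = trans (cong (f zero ∨_) (any-before-end (f ∘ suc) x fx≡)) (∨-zeroʳ (f zero))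

  -- A round consists of `release`, n times `take` and `put`, `ask`, `choose`, and n moves. The
  -- budget adds the n initial `enter` steps to one round per clause.
  roundLength budget : ℕ
  roundLength = 1 + (n * 2 + (1 + (1 + n * 1)))
  budget = n * 1 + m * roundLength

  module Completeness (α : Fin n → Bool) (satisfied : ∀ i → SatisfiedBy α (lookup L i)) where

    gathered : Fin (suc m) → Fin n → State
    gathered k x = at? x (α x) marked (clauseAt L k)

    entering : Reach (n * 1) (release ▸ λ _ → init) (val zero) (release ▸ gathered zero) (val zero)
    entering = sweep (λ _ → init) (gathered zero) (λ _ → val zero) 1 λ y → reach-step (enter y (α y)) read

    round : ∀ i → Reach roundLength (release ▸ gathered (inject₁ i)) (val (inject₁ i)) (release ▸ gathered (suc i)) (val (suc i))
    round i =
      reach-≗ (▸-cong λ x → cong (at? x (α x) marked) (clauseAt-lookup L i)) (λ _ → refl)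
        (reach-step {st′ = ask ▸ phase marked} release write refl refl (ctl-only λ _ → refl)) ∙∙
      token-pass ∙∙
      reach-step {st′ = choose ▸ phase idle} ask read refl refl (ctl-only λ _ → refl) ∙∙
      reach-step {st′ = release ▸ phase idle} (choose i) write refl refl (ctl-only λ _ → refl) ∙∙
      sweep (phase idle) (gathered (suc i)) (λ _ → val (suc i)) 1 (λ y → reach-step (move y (α y) i) read)
      where
      C : List (Literal n)
      C = lookup L i
      phase : Phase → Fin n → State
      phase φ x = at x (α x) φ C
      ctl-only : ∀ {s s′ st st′} → (∀ x → st′ x ≡ st x) → ∀ j → j ≢ zero → (s′ ▸ st′) j ≡ (s ▸ st) j
      ctl-only eq zero    0≢0 = ⊥-elim (0≢0 refl)
      ctl-only eq (suc x) _   = eq x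
      hits : Fin n → Bool
      hits x = sat (α x) (member (x , true) C) (member (x , false) C)
      token-pass : Reach (n * 2) (ask ▸ phase marked) (tok zero false) (ask ▸ phase idle) (tok (fromℕ n) true)
      token-pass = subst (λ s → Reach (n * 2) (ask ▸ phase marked) (tok zero false) (ask ▸ phase idle) (tok (fromℕ n) s))
        (any-before-end hits (proj₁ (satisfied i)) (trans (member-sat _ _ C) (proj₂ (satisfied i))))
        (sweep (phase marked) (phase idle) (λ y → tok y (any-before hits y)) 2 handover)
        where
        handover : ∀ y {st st′} → st (suc y) ≡ phase marked y → st′ (suc y) ≡ phase idle y →
          (∀ i → i ≢ suc y → st′ i ≡ st i) →
          Reach 2 st (tok (inject₁ y) (any-before hits (inject₁ y))) st′ (tok (suc y) (any-before hits (suc y)))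
        handover y {st} {st′} st-y st′-y same rewrite any-before-suc hits y =
          reach-step {st′ = via} (take y (α y) _ _ _) read st-y (updateAt-updates (suc y) st)
            (λ j j≢ → updateAt-minimal j (suc y) st j≢) ∙∙
          reach-step (put y (α y) _ _ _) write (updateAt-updates (suc y) st) st′-y
            (λ j j≢ → trans (same j j≢) (sym (updateAt-minimal j (suc y) st j≢)))
          where
          via : Fin (suc n) → State
          via = updateAt st (suc y) (λ _ → phase (pass (any-before hits (inject₁ y) ∨ hits y)) y)

    AfterRounds : ℕ → Fin (suc m) → Set
    AfterRounds r k = Reach (r * roundLength) (release ▸ gathered zero) (val zero) (release ▸ gathered k) (val k)

    all-rounds : Reach budget (release ▸ λ _ → init) (val zero) (release ▸ λ _ → end) (val (fromℕ m))
    all-rounds = reach-≗ (λ _ → refl)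
      (▸-cong {st = gathered (fromℕ m)} λ x → cong (at? x (α x) marked) (clauseAt-end L))
      (entering ∙∙ subst (λ r → AfterRounds r (fromℕ m)) (toℕ-fromℕ m)
        (<-weakInduction (λ k → AfterRounds (toℕ k) k) (λ view → _ , view , []) next (fromℕ m)))
      where
      next : ∀ i → AfterRounds (toℕ (inject₁ i)) (inject₁ i) → AfterRounds (suc (toℕ i)) (suc i)
      next i r rewrite toℕ-inject₁ i | +-comm roundLength (toℕ i * roundLength) = r ∙∙ round i

  complete : (∃[ α ] ∀ i → SatisfiedBy α (lookup L i)) → ∀ k → budget ≤ k →
    ∃[ c ] c ≈ final × StagedComputation k c⁰ c
  complete (α , satisfied) k budget≤k
    with c , view , comp ← Completeness.all-rounds α satisfied (record { states = λ _ → refl ; memory = refl }) =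
    c , (View.states view , View.memory view) ,
    subst (λ k → StagedComputation k c⁰ c) (m+[n∸m]≡n budget≤k) (comp ++ˢ idling (k ∸ budget))

-- Comparison of clauses and removal of duplicates

bit-injective : ∀ b c → bit b ≡ bit c → b ≡ c
bit-injective false false _ = refl
bit-injective true  true  _ = refl

sameLiteral-sound : ∀ {n} (l k : Literal n) → sameLiteral l k ≡ true → l ≡ k
sameLiteral-sound (x , b) (y , c) eq with Equivalence.to T-∧ (Equivalence.from T-≡ eq)
... | x≡y , b≡c = cong₂ _,_ (toℕ-injective (≡ᵇ⇒≡ _ _ x≡y)) (bit-injective b c (≡ᵇ⇒≡ _ _ b≡c))

sameLiteral-refl : ∀ {n} (l : Literal n) → sameLiteral l l ≡ true
sameLiteral-refl (x , b) =
  Equivalence.to T-≡ (Equivalence.from T-∧ (≡⇒≡ᵇ (toℕ x) (toℕ x) refl , ≡⇒≡ᵇ (bit b) (bit b) refl))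

member-complete : ∀ {n} {l : Literal n} {C} → l ∈ C → member l C ≡ true
member-complete {l = l} {_ ∷ C} (here refl) = trans (cong (member l C ∨_) (sameLiteral-refl l)) (∨-zeroʳ _)
member-complete {l = l} {k ∷ C} (there l∈C) = cong (_∨ sameLiteral k l) (member-complete l∈C)

member-sound : ∀ {n} (l : Literal n) C → member l C ≡ true → l ∈ C
member-sound l (k ∷ C) eq with member l C in l∈?C
... | true  = there (member-sound l C l∈?C)
... | false = here (sym (sameLiteral-sound k l eq))

missing-true : ∀ {n} (C D : List (Literal n)) → missing C D ≡ true → ∃[ l ] l ∈ C × member l D ≡ false
missing-true (l ∷ C) D eq with missing C D in rest | member l D in l∈?D
... | true  | _     with missing-true C D rest
...   | k , k∈C , k∉D = k , there k∈C , k∉D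
missing-true (l ∷ C) D eq | false | false = l , here refl , l∈?D

missing-false : ∀ {n} {l : Literal n} {C} D → missing C D ≡ false → l ∈ C → member l D ≡ true
missing-false {C = k ∷ C} D eq l∈C with missing C D in rest | member k D in k∈?D
missing-false D eq (here refl)  | false | true = k∈?D
missing-false D eq (there l∈C) | false | true = missing-false D rest l∈C

SameLiterals : ∀ {n} → List (Literal n) → List (Literal n) → Set
SameLiterals C D = ∀ x b → member (x , b) C ≡ member (x , b) D

differ-true : ∀ {n} (C D : List (Literal n)) → differ C D ≡ true → ¬ SameLiterals C D
differ-true C D eq same with missing C D in C⊈D
... | true  with missing-true C D C⊈D
...   | (x , b) , l∈C , l∉D with () ← trans (sym (member-complete l∈C)) (trans (same x b) l∉D)
differ-true C D eq same | false with missing-true D C eq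
...   | (x , b) , l∈D , l∉C with () ← trans (sym (member-complete l∈D)) (trans (sym (same x b)) l∉C)

differ-false : ∀ {n} (C D : List (Literal n)) → differ C D ≡ false → SameLiterals C D
differ-false C D eq x b with missing C D in C⊆D
... | false with member (x , b) C in l∈?C
...   | true  = sym (missing-false D C⊆D (member-sound _ C l∈?C))
...   | false with member (x , b) D in l∈?D
...     | false = refl
...     | true with () ← trans (sym l∈?C) (missing-false C eq (member-sound _ D l∈?D))

repeated-true : ∀ {n} (C : List (Literal n)) Ds → repeated C Ds ≡ true → ∃[ D ] D ∈ Ds × SameLiterals C D
repeated-true C (D ∷ Ds) eq with repeated C Ds in rest | differ C D in C≠?D
... | false | false = D , here refl , differ-false C D C≠?D
... | true  | _     with repeated-true C Ds rest
...   | E , E∈Ds , same = E , there E∈Ds , same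

repeated-false : ∀ {n} (C : List (Literal n)) Ds → repeated C Ds ≡ false → ∀ {D} → D ∈ Ds → ¬ SameLiterals C D
repeated-false C (D ∷ Ds) eq D∈ with repeated C Ds in rest | differ C D in C≠?D
repeated-false C (D ∷ Ds) eq (here refl) | false | true = differ-true C D C≠?D
repeated-false C (D ∷ Ds) eq (there D∈)  | false | true = repeated-false C Ds rest D∈

dedup-⊆ : ∀ {n C} (Cs : List (List (Literal n))) → C ∈ dedup Cs → C ∈ Cs
dedup-⊆ (D ∷ Ds) C∈ with ∈-++⁻ (dedup Ds) C∈
... | inj₁ C∈Ds = there (dedup-⊆ Ds C∈Ds)
... | inj₂ C∈D with repeated D Ds | C∈D
...   | false | here refl = here refl

dedup-covers : ∀ {n C} (Cs : List (List (Literal n))) → C ∈ Cs → ∃[ D ] D ∈ dedup Cs × SameLiterals C D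
dedup-covers (D ∷ Ds) (there C∈) with dedup-covers Ds C∈
... | E , E∈ , same = E , ∈-++⁺ˡ E∈ , same
dedup-covers (D ∷ Ds) (here refl) with repeated D Ds in rep
... | false = D , ∈-++⁺ʳ (dedup Ds) (here refl) , λ _ _ → refl
... | true with repeated-true D Ds rep
...   | E , E∈ , same with dedup-covers Ds E∈
...     | F , F∈ , same′ = F , ∈-++⁺ˡ F∈ , λ x b → trans (same x b) (same′ x b)

dedup-pairs : ∀ {n} (Cs : List (List (Literal n))) → AllPairs (λ C D → ¬ SameLiterals C D) (dedup Cs)
dedup-pairs []       = []
dedup-pairs (C ∷ Cs) with repeated C Cs in rep
... | true  = AllPairs.++⁺ (dedup-pairs Cs) [] (All.tabulate λ _ → [])
... | false = AllPairs.++⁺ (dedup-pairs Cs) ([] ∷ []) (All.tabulate λ D∈ →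
  (λ same → repeated-false C Cs rep (dedup-⊆ Cs D∈) (λ x b → sym (same x b))) ∷ [])

pairs-distinct : ∀ {n} {L : List (List (Literal n))} → AllPairs (λ C D → ¬ SameLiterals C D) L →
  ∀ i j → SameLiterals (lookup L i) (lookup L j) → i ≡ j
pairs-distinct (C∉ ∷ ps) zero    zero    same = refl
pairs-distinct {L = C ∷ L} (C∉ ∷ ps) zero    (suc j) same = ⊥-elim (All.lookup C∉ (∈-lookup {xs = L} j) same)
pairs-distinct {L = C ∷ L} (C∉ ∷ ps) (suc i) zero    same = ⊥-elim (All.lookup C∉ (∈-lookup {xs = L} i) (λ x b → sym (same x b)))
pairs-distinct (C∉ ∷ ps) (suc i) (suc j) same = cong suc (pairs-distinct ps i j same)

-- The instance and its correctness

-- The stage bound is twos k for a large k: k digits 2 in bijective binary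
-- notation, so that its encoding is the unary numeral k.
twos : ℕ → ℕᵇ
twos zero    = ℕᵇ.zero
twos (suc k) = 2[1+ twos k ]

k≤twos : ∀ k → k ≤ ℕᵇ.toℕ (twos k)
k≤twos zero    = z≤n
k≤twos (suc k) = ≤-trans (s≤s (k≤twos k)) (m≤m+n _ _)

module Reduction (φ : 3-CNF) where
  open 3-CNF φ

  cls L : List (List (Literal variables))
  cls = map Vec.toList clauses
  L   = dedup cls

  open Machine variables L public

  satisfiable⇔ : Satisfiable φ ⇔ (∃[ α ] ∀ i → SatisfiedBy α (lookup L i))
  satisfiable⇔ = mk⇔ to from
    where
    to : Satisfiable φ → ∃[ α ] ∀ i → SatisfiedBy α (lookup L i)
    to (α , all) = α , λ i → by (∈-map⁻ Vec.toList (dedup-⊆ cls (∈-lookup i)))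
      where
      by : ∀ {C} → ∃[ v ] v ∈ clauses × C ≡ Vec.toList v → SatisfiedBy α C
      by (v , v∈ , refl) with find (toList⁺ (All.lookup all v∈))
      ... | (x , b) , l∈ , refl = x , member-complete l∈
    from : (∃[ α ] ∀ i → SatisfiedBy α (lookup L i)) → Satisfiable φ
    from (α , sat) = α , All.tabulate λ v∈ → by (dedup-covers cls (∈-map⁺ Vec.toList v∈))
      where
      by : ∀ {v} → ∃[ D ] D ∈ L × SameLiterals (Vec.toList v) D → _
      by {v} (D , D∈ , same) with subst (SatisfiedBy α) (sym (lookup-index D∈)) (sat (Any.index D∈))
      ... | x , x∈D = toList⁻ (lose (member-sound _ (Vec.toList v) (trans (same x (α x)) x∈D)) refl)

  -- This is `budget`, rearranged into the shape that the builder `digitsᴮ` outputs. As a number of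
  -- digits it yields a stage bound that is at least as large.
  stageDigits : ℕ
  stageDigits = variables + m * (3 + (variables + (variables + variables)))

  budget≤ : budget ≤ stageDigits
  budget≤ = ≤-reflexive (expand variables m)
    where
    expand : ∀ n m → n * 1 + m * (1 + (n * 2 + (1 + (1 + n * 1)))) ≡ n + m * (3 + (n + (n + n)))
    expand = solve-∀

  bsr : BSR-Instance
  bsr = record { 𝒜 = program ; Cᶠ = final ∷ [] ; s = ℕᵇ.toℕ (twos stageDigits) }

  correct : BSR-Yes bsr ⇔ Satisfiable φ
  correct = mk⇔
    (λ { (c , here c≈final , comp) →
      Equivalence.from satisfiable⇔ (sound (pairs-distinct (dedup-pairs cls)) c≈final comp) })
    λ sat → let c , c≈final , comp = complete (Equivalence.to satisfiable⇔ sat) _ (≤-trans budget≤ (k≤twos stageDigits))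
            in c , here c≈final , comp

-- Terms for testing clauses

nonempty : List Tree → Bool
nonempty ts = truthy (enc-trees ts)

-- This turns loops into existential quantifiers: a loop that emits `nil` for each witness has a
-- truthy result iff there is a witness.
nonempty-++ : ∀ xs ys → nonempty (xs ++ ys) ≡ nonempty xs ∨ nonempty ys
nonempty-++ []       ys = refl
nonempty-++ (x ∷ xs) ys = refl

-- Branching exists for builders only, hence the detour through a one-element list.
ite : ∀ {k} → Term k → Term k → Term k → Term k
ite c e f = hd (build (when c (emit e) (emit f)))

⟦ite⟧ : ∀ {k} c (e f : Term k) ρ → ⟦ ite c e f ⟧ ρ ≡ (ifᵇ truthy (⟦ c ⟧ ρ) then ⟦ e ⟧ ρ else ⟦ f ⟧ ρ)
⟦ite⟧ c e f ρ with truthy (⟦ c ⟧ ρ)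
... | true  = refl
... | false = refl

quoted : ∀ {k} → Tree → Term k
quoted nil     = nil
quoted (l ∙ r) = cons (quoted l) (quoted r)

⟦quoted⟧ : ∀ {k} t (ρ : Vec Tree k) → ⟦ quoted t ⟧ ρ ≡ t
⟦quoted⟧ nil     ρ = refl
⟦quoted⟧ (l ∙ r) ρ = cong₂ _∙_ (⟦quoted⟧ l ρ) (⟦quoted⟧ r ρ)

dropᵗ-nil : ∀ t → dropᵗ t nil ≡ nil
dropᵗ-nil nil     = refl
dropᵗ-nil (_ ∙ r) = dropᵗ-nil r

-- On unary numerals `drop` is truncated subtraction, and two numbers are equal iff both differences
-- vanish.
equalᵀ : ∀ {k} → Term k → Term k → Term k
equalᵀ e f = ite (drop e f) nil (ite (drop f e) nil (quoted (nil ∙ nil)))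

equalᵀ-unary : ∀ {k} (e f : Term k) ρ i j → ⟦ e ⟧ ρ ≡ enc-unary i → ⟦ f ⟧ ρ ≡ enc-unary j →
  truthy (⟦ equalᵀ e f ⟧ ρ) ≡ (i ≡ᵇ j)
equalᵀ-unary e f ρ i j e≡ f≡
  rewrite ⟦ite⟧ (drop e f) nil (ite (drop f e) nil (quoted (nil ∙ nil))) ρ
        | ⟦ite⟧ (drop f e) nil (quoted (nil ∙ nil)) ρ | e≡ | f≡ = compare i j
  where
  compare : ∀ i j → truthy (ifᵇ truthy (dropᵗ (enc-unary i) (enc-unary j)) then nil
    else (ifᵇ truthy (dropᵗ (enc-unary j) (enc-unary i)) then nil else nil ∙ nil)) ≡ (i ≡ᵇ j)
  compare zero    zero    = refl
  compare zero    (suc j) = refl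
  compare (suc i) zero    rewrite dropᵗ-nil (enc-unary i) = refl
  compare (suc i) (suc j) = compare i j

enc-literal : ∀ {n} → Literal n → Tree
enc-literal (x , b) = enc-Fin x ∙ enc-Bool b

enc-literals : ∀ {n} → List (Literal n) → Tree
enc-literals = enc-List enc-literal

enc-Bool-bit : ∀ b → enc-Bool b ≡ enc-unary (bit b)
enc-Bool-bit false = refl
enc-Bool-bit true  = refl

sameLiteralᵀ : ∀ {k} → Term k → Term k → Term k
sameLiteralᵀ e f = ite (equalᵀ (hd e) (hd f)) (equalᵀ (tl e) (tl f)) nil

⟦sameLiteral⟧ : ∀ {k n} (e f : Term k) ρ (l l′ : Literal n) →
  ⟦ e ⟧ ρ ≡ enc-literal l → ⟦ f ⟧ ρ ≡ enc-literal l′ → truthy (⟦ sameLiteralᵀ e f ⟧ ρ) ≡ sameLiteral l l′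
⟦sameLiteral⟧ e f ρ (x , b) (y , c) e≡ f≡
  rewrite ⟦ite⟧ (equalᵀ (hd e) (hd f)) (equalᵀ (tl e) (tl f)) nil ρ
        | equalᵀ-unary (hd e) (hd f) ρ (toℕ x) (toℕ y) (cong hdᵗ e≡) (cong hdᵗ f≡)
  with toℕ x ≡ᵇ toℕ y
... | false = refl
... | true  = equalᵀ-unary (tl e) (tl f) ρ (bit b) (bit c)
  (trans (cong tlᵗ e≡) (enc-Bool-bit b)) (trans (cong tlᵗ f≡) (enc-Bool-bit c))

memberᵀ : ∀ {k} → Fin k → Fin k → Term k
memberᵀ l c = build (for (var c) (when (sameLiteralᵀ (hd (var 0F)) (var (suc l))) (emit nil) none))

⟦member⟧ : ∀ {k n} (l c : Fin k) ρ (lit : Literal n) C →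
  Vec.lookup ρ l ≡ enc-literal lit → Vec.lookup ρ c ≡ enc-literals C → truthy (⟦ memberᵀ l c ⟧ ρ) ≡ member lit C
⟦member⟧ l c ρ lit C l≡ c≡ rewrite c≡ = go C
  where
  f : Tree → List Tree
  f w = ⟦ when (sameLiteralᵀ (hd (var 0F)) (var (suc l))) (emit nil) none ⟧ᴮ (w Vec.∷ ρ)
  nonempty-f : ∀ k C → nonempty (f (enc-literals (k ∷ C))) ≡ sameLiteral k lit
  nonempty-f k C rewrite ⟦sameLiteral⟧ (hd (var 0F)) (var (suc l)) (enc-literals (k ∷ C) Vec.∷ ρ) k lit refl l≡
    with sameLiteral k lit
  ... | true  = refl
  ... | false = refl
  go : ∀ C → nonempty (gather f (enc-literals C)) ≡ member lit C
  go []      = refl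
  go (k ∷ C) = trans (nonempty-++ (gather f (enc-literals C)) _) (cong₂ _∨_ (go C) (nonempty-f k C))

missingᴮ : ∀ {k} → Fin k → Fin k → Builder k
missingᴮ c d = for (var c) (when (bind (hd (var 0F)) (memberᵀ 0F (suc (suc d)))) none (emit nil))

⟦missing⟧ : ∀ {k n} (c d : Fin k) ρ (C D : List (Literal n)) →
  Vec.lookup ρ c ≡ enc-literals C → Vec.lookup ρ d ≡ enc-literals D → nonempty (⟦ missingᴮ c d ⟧ᴮ ρ) ≡ missing C D
⟦missing⟧ c d ρ C D c≡ d≡ rewrite c≡ = go C
  where
  f : Tree → List Tree
  f w = ⟦ when (bind (hd (var 0F)) (memberᵀ 0F (suc (suc d)))) none (emit nil) ⟧ᴮ (w Vec.∷ ρ)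
  nonempty-f : ∀ l C → nonempty (f (enc-literals (l ∷ C))) ≡ not (member l D)
  nonempty-f l C rewrite ⟦member⟧ 0F (suc (suc d)) (enc-literal l Vec.∷ enc-literals (l ∷ C) Vec.∷ ρ) l D refl d≡
    with member l D
  ... | true  = refl
  ... | false = refl
  go : ∀ C → nonempty (gather f (enc-literals C)) ≡ missing C D
  go []      = refl
  go (l ∷ C) = trans (nonempty-++ (gather f (enc-literals C)) _) (cong₂ _∨_ (go C) (nonempty-f l C))

differᵀ : ∀ {k} → Fin k → Fin k → Term k
differᵀ c d = build (missingᴮ c d ⊕ missingᴮ d c)

⟦differ⟧ : ∀ {k n} (c d : Fin k) ρ (C D : List (Literal n)) →
  Vec.lookup ρ c ≡ enc-literals C → Vec.lookup ρ d ≡ enc-literals D → truthy (⟦ differᵀ c d ⟧ ρ) ≡ differ C D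
⟦differ⟧ c d ρ C D c≡ d≡ = trans (nonempty-++ (⟦ missingᴮ c d ⟧ᴮ ρ) _)
  (cong₂ _∨_ (⟦missing⟧ c d ρ C D c≡ d≡) (⟦missing⟧ d c ρ D C d≡ c≡))

enc-clauses : ∀ {n} → List (List (Literal n)) → Tree
enc-clauses = enc-List enc-literals

repeatedᵀ : ∀ {k} → Fin k → Term k → Term k
repeatedᵀ c ds = build (for ds (when (bind (hd (var 0F)) (differᵀ (suc (suc c)) 0F)) none (emit nil)))

⟦repeated⟧ : ∀ {k n} (c : Fin k) ds ρ (C : List (Literal n)) Ds →
  Vec.lookup ρ c ≡ enc-literals C → ⟦ ds ⟧ ρ ≡ enc-clauses Ds → truthy (⟦ repeatedᵀ c ds ⟧ ρ) ≡ repeated C Ds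
⟦repeated⟧ c ds ρ C Ds c≡ ds≡ rewrite ds≡ = go Ds
  where
  f : Tree → List Tree
  f w = ⟦ when (bind (hd (var 0F)) (differᵀ (suc (suc c)) 0F)) none (emit nil) ⟧ᴮ (w Vec.∷ ρ)
  nonempty-f : ∀ D Ds → nonempty (f (enc-clauses (D ∷ Ds))) ≡ not (differ C D)
  nonempty-f D Ds rewrite ⟦differ⟧ (suc (suc c)) 0F (enc-literals D Vec.∷ enc-clauses (D ∷ Ds) Vec.∷ ρ) C D c≡ refl
    with differ C D
  ... | true  = refl
  ... | false = refl
  go : ∀ Ds → nonempty (gather f (enc-clauses Ds)) ≡ repeated C Ds
  go []       = refl
  go (D ∷ Ds) = trans (nonempty-++ (gather f (enc-clauses Ds)) _) (cong₂ _∨_ (go Ds) (nonempty-f D Ds))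

-- Besides the current clause the body inspects the clauses after it, which the loop provides by
-- passing suffixes instead of elements.
dedupᵀ : ∀ {k} → Term k → Term k
dedupᵀ cs = build (for cs (when (bind (hd (var 0F)) (repeatedᵀ 0F (tl (var 1F)))) none (emit (hd (var 0F)))))

⟦dedup⟧ : ∀ {k n} cs (ρ : Vec Tree k) (Cs : List (List (Literal n))) →
  ⟦ cs ⟧ ρ ≡ enc-clauses Cs → ⟦ dedupᵀ cs ⟧ ρ ≡ enc-clauses (dedup Cs)
⟦dedup⟧ cs ρ Cs cs≡ rewrite cs≡ = cong enc-trees (go Cs)
  where
  f : Tree → List Tree
  f w = ⟦ when (bind (hd (var 0F)) (repeatedᵀ 0F (tl (var 1F)))) none (emit (hd (var 0F))) ⟧ᴮ (w Vec.∷ ρ)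
  f≡ : ∀ C Cs → f (enc-clauses (C ∷ Cs)) ≡ map enc-literals (ifᵇ repeated C Cs then [] else (C ∷ []))
  f≡ C Cs rewrite ⟦repeated⟧ 0F (tl (var 1F)) (enc-literals C Vec.∷ enc-clauses (C ∷ Cs) Vec.∷ ρ) C Cs refl refl
    with repeated C Cs
  ... | true  = refl
  ... | false = refl
  go : ∀ Cs → gather f (enc-clauses Cs) ≡ map enc-literals (dedup Cs)
  go []       = refl
  go (C ∷ Cs) = trans (cong₂ _++_ (go Cs) (f≡ C Cs)) (sym (map-++ enc-literals (dedup Cs) _))

-- Loops over numerals

tabulate-∷ʳ : ∀ {A : Set} {m} (g : Fin (suc m) → A) → tabulate g ≡ tabulate (g ∘ inject₁) ++ g (fromℕ m) ∷ []
tabulate-∷ʳ {m = zero}  g = refl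
tabulate-∷ʳ {m = suc m} g = cong (g zero ∷_) (tabulate-∷ʳ (g ∘ suc))

-- The suffixes of the numeral m are visited downwards and never include `nil`, so index j is seen
-- as `suc j`; the reversal in `gather` restores the ascending order.
gather-unary : ∀ m {f} (g : Fin m → List Tree) → (∀ j → f (enc-unary (suc (toℕ j))) ≡ g j) →
  gather f (enc-unary m) ≡ concat (tabulate g)
gather-unary zero    g h = refl
gather-unary (suc m) {f} g h = begin
  gather f (enc-unary m) ++ f (enc-unary (suc m))
    ≡⟨ cong₂ _++_ (gather-unary m (g ∘ inject₁) λ j → trans (cong (f ∘ enc-unary ∘ suc) (sym (toℕ-inject₁ j))) (h (inject₁ j)))
                  (trans (cong (f ∘ enc-unary ∘ suc) (sym (toℕ-fromℕ m))) (h (fromℕ m))) ⟩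
  concat (tabulate (g ∘ inject₁)) ++ g (fromℕ m)
    ≡⟨ cong (concat (tabulate (g ∘ inject₁)) ++_) (++-identityʳ (g (fromℕ m))) ⟨
  concat (tabulate (g ∘ inject₁)) ++ concat (g (fromℕ m) ∷ [])
    ≡⟨ concat-++ (tabulate (g ∘ inject₁)) (g (fromℕ m) ∷ []) ⟩
  concat (tabulate (g ∘ inject₁) ++ g (fromℕ m) ∷ [])
    ≡⟨ cong concat (tabulate-∷ʳ g) ⟨
  concat (tabulate g) ∎
  where
  open ≡-Reasoning

gather-unary₁ : ∀ m {f} (g : Fin m → Tree) → (∀ j → f (enc-unary (suc (toℕ j))) ≡ g j ∷ []) →
  gather f (enc-unary m) ≡ tabulate g
gather-unary₁ m g h = trans (gather-unary m (λ j → g j ∷ []) h)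
  (trans (cong concat (sym (map-tabulate g (_∷ [])))) concat-map-[ tabulate g ])

-- Evaluation as record types, from which Agda can infer e, b and ρ.

infix 4 _⊢_⇓_ _⊢_⇓ᴮ_

record _⊢_⇓_ {k} (ρ : Vec Tree k) (e : Term k) (t : Tree) : Set where
  constructor by
  field evaluates : ⟦ e ⟧ ρ ≡ t

record _⊢_⇓ᴮ_ {k} (ρ : Vec Tree k) (b : Builder k) (ts : List Tree) : Set where
  constructor by
  field evaluatesᴮ : ⟦ b ⟧ᴮ ρ ≡ ts

open _⊢_⇓_
open _⊢_⇓ᴮ_

⇓-cons : ∀ {k} {ρ : Vec Tree k} {e f t u} → ρ ⊢ e ⇓ t → ρ ⊢ f ⇓ u → ρ ⊢ cons e f ⇓ t ∙ u
⇓-cons (by e⇓) (by f⇓) = by (cong₂ _∙_ e⇓ f⇓)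

⇓-quoted : ∀ {k} {ρ : Vec Tree k} t → ρ ⊢ quoted t ⇓ t
⇓-quoted t = by (⟦quoted⟧ t _)

⇓-build : ∀ {k} {ρ : Vec Tree k} {b ts} → ρ ⊢ b ⇓ᴮ ts → ρ ⊢ build b ⇓ enc-trees ts
⇓-build (by b⇓) = by (cong enc-trees b⇓)

⇓-emit : ∀ {k} {ρ : Vec Tree k} {e t} → ρ ⊢ e ⇓ t → ρ ⊢ emit e ⇓ᴮ t ∷ []
⇓-emit (by e⇓) = by (cong (_∷ []) e⇓)

⇓-⊕ : ∀ {k} {ρ : Vec Tree k} {b c ts us} → ρ ⊢ b ⇓ᴮ ts → ρ ⊢ c ⇓ᴮ us → ρ ⊢ b ⊕ c ⇓ᴮ ts ++ us
⇓-⊕ (by b⇓) (by c⇓) = by (cong₂ _++_ b⇓ c⇓)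

⇓-for : ∀ {k} {ρ : Vec Tree k} {e b} m (g : Fin m → List Tree) → ρ ⊢ e ⇓ enc-unary m →
  (∀ j → enc-unary (suc (toℕ j)) Vec.∷ ρ ⊢ b ⇓ᴮ g j) → ρ ⊢ for e b ⇓ᴮ concat (tabulate g)
⇓-for m g (by e⇓) h = by (trans (cong (gather _) e⇓) (gather-unary m g λ j → evaluatesᴮ (h j)))

⇓-for₁ : ∀ {k} {ρ : Vec Tree k} {e b} m (g : Fin m → Tree) → ρ ⊢ e ⇓ enc-unary m →
  (∀ j → enc-unary (suc (toℕ j)) Vec.∷ ρ ⊢ b ⇓ᴮ g j ∷ []) → ρ ⊢ for e b ⇓ᴮ tabulate g
⇓-for₁ m g (by e⇓) h = by (trans (cong (gather _) e⇓) (gather-unary₁ m g λ j → evaluatesᴮ (h j)))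

-- Arithmetic in unary: b counts k if it outputs k copies of nil.

nils : ℕ → List Tree
nils k = replicate k nil

record Counts {l} (ρ : Vec Tree l) (b : Builder l) (k : ℕ) : Set where
  constructor by
  field counts : ⟦ b ⟧ᴮ ρ ≡ nils k

open Counts

enc-trees-nils : ∀ k → enc-trees (nils k) ≡ enc-unary k
enc-trees-nils zero    = refl
enc-trees-nils (suc k) = cong (nil ∙_) (enc-trees-nils k)

build-counts : ∀ {l} {ρ : Vec Tree l} {b k} → Counts ρ b k → ρ ⊢ build b ⇓ enc-unary k
build-counts {k = k} (by h) = by (trans (cong enc-trees h) (enc-trees-nils k))

nils-+ : ∀ j k → nils j ++ nils k ≡ nils (j + k)
nils-+ zero    k = refl
nils-+ (suc j) k = cong (nil ∷_) (nils-+ j k)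

⊕-counts : ∀ {l} {ρ : Vec Tree l} {b c j k} → Counts ρ b j → Counts ρ c k → Counts ρ (b ⊕ c) (j + k)
⊕-counts {j = j} {k} (by hb) (by hc) = by (trans (cong₂ _++_ hb hc) (nils-+ j k))

for-counts : ∀ {l} {ρ : Vec Tree l} {e b k} ts → ρ ⊢ e ⇓ enc-trees ts → (∀ w → Counts (w Vec.∷ ρ) b k) →
  Counts ρ (for e b) (length ts * k)
for-counts {ρ = ρ} {b = b} {k} ts (by e⇓) h = by (trans (cong (gather _) e⇓) (go ts))
  where
  go : ∀ ts → gather (λ w → ⟦ b ⟧ᴮ (w Vec.∷ ρ)) (enc-trees ts) ≡ nils (length ts * k)
  go []       = refl
  go (t ∷ ts) = trans (cong₂ _++_ (go ts) (counts (h (enc-trees (t ∷ ts)))))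
    (trans (nils-+ (length ts * k) k) (cong nils (+-comm (length ts * k) k)))

for-unary-counts : ∀ {l} {ρ : Vec Tree l} {e b k} j → ρ ⊢ e ⇓ enc-unary j → (∀ w → Counts (w Vec.∷ ρ) b k) →
  Counts ρ (for e b) (j * k)
for-unary-counts {ρ = ρ} {e} {b} {k} j (by e⇓) h =
  subst (λ i → Counts ρ (for e b) (i * k)) (length-replicate j)
    (for-counts (nils j) (by (trans e⇓ (sym (enc-trees-nils j)))) h)

one : ∀ {k} → Builder k
one = emit nil

one-counts : ∀ {l} {ρ : Vec Tree l} → Counts ρ one 1
one-counts = by refl

units : ∀ {k} → Term k → Builder k
units e = for e one

units-length : ∀ {l} {ρ : Vec Tree l} {e} ts → ρ ⊢ e ⇓ enc-trees ts → Counts ρ (units e) (length ts)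
units-length {ρ = ρ} {e} ts e⇓ =
  subst (Counts ρ (units e)) (*-identityʳ (length ts)) (for-counts ts e⇓ λ _ → one-counts)

units-counts : ∀ {l} {ρ : Vec Tree l} {e k} → ρ ⊢ e ⇓ enc-unary k → Counts ρ (units e) k
units-counts {ρ = ρ} {e} {k} e⇓ =
  subst (Counts ρ (units e)) (*-identityʳ k) (for-unary-counts k e⇓ λ _ → one-counts)

-- A loop over a list known in advance, unrolled into the syntax.
each : ∀ {A : Set} {k} → List A → (A → Builder k) → Builder k
each as f = foldr (λ a b → f a ⊕ b) none as

⇓-each : ∀ {A B : Set} {k} {ρ : Vec Tree k} {f : A → Builder k} (h : B → Tree) (g : A → List B) as →
  (∀ a → ρ ⊢ f a ⇓ᴮ map h (g a)) → ρ ⊢ each as f ⇓ᴮ map h (concatMap g as)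
⇓-each h g []       eq = by refl
⇓-each h g (a ∷ as) eq =
  by (trans (evaluatesᴮ (⇓-⊕ (eq a) (⇓-each h g as eq))) (sym (map-++ h (g a) _)))

⇓-each₁ : ∀ {A B : Set} {k} {ρ : Vec Tree k} {f : A → Builder k} (h : B → Tree) (g : A → B) as →
  (∀ a → ρ ⊢ f a ⇓ᴮ h (g a) ∷ []) → ρ ⊢ each as f ⇓ᴮ map h (map g as)
⇓-each₁ h g []       eq = by refl
⇓-each₁ h g (a ∷ as) eq = ⇓-⊕ (eq a) (⇓-each₁ h g as eq)

-- The reduction as a term

-- In the following terms, vn, vx and vc are variables for the number n of
-- propositional variables, for suc x where x is the variable that a thread is
-- in charge of, and for a clause.

tokᴮ : ∀ {k} → Bool → Fin k → Builder k → Builder k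
tokᴮ false vn y = y
tokᴮ true  vn y = (one ⊕ units (var vn)) ⊕ y

valᴮ : ∀ {k} → Fin k → Builder k → Builder k
valᴮ vn j = ((one ⊕ units (var vn)) ⊕ (one ⊕ units (var vn))) ⊕ j

stateᵀ : ∀ {k} → State → Term k
stateᵀ s = quoted (enc-Fin ⌊ s ⌋ˢ)

readᵀ writeᵀ : ∀ {k} → Builder k → Term k
readᵀ b  = cons nil (build b)
writeᵀ b = cons (quoted (nil ∙ nil)) (build b)

ruleᴮ : ∀ {k} → Term k → Term k → Term k → Builder k
ruleᴮ s o s′ = emit (cons s (cons o s′))

-- Variables 1 and 0 hold the two literals of x.
selectᵀ : ∀ {k} → Bool → Phase → Fin (2 + k) → Term (2 + k)
selectᵀ b φ vc = ite (memberᵀ 1F vc)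
  (ite (memberᵀ 0F vc) (stateᵀ (act b true true φ)) (stateᵀ (act b true false φ)))
  (ite (memberᵀ 0F vc) (stateᵀ (act b false true φ)) (stateᵀ (act b false false φ)))

atᵀ : ∀ {k} → Bool → Phase → (vx vc : Fin k) → Term k
atᵀ b φ vx vc =
  bind (cons (tl (var vx)) (quoted (enc-Bool true))) (
  bind (cons (tl (var (suc vx))) (quoted (enc-Bool false)))
  (selectᵀ b φ (suc (suc vc))))

-- u stands for the list of clauses from the current one on.
at?ᵀ : ∀ {k} → Bool → Phase → Fin k → Term k → Term k
at?ᵀ b φ vx u = ite u (bind (hd u) (atᵀ b φ (suc vx) 0F)) (stateᵀ end)

-- Variables 0 to 3 are the number m of distinct clauses, their list, n and the input; each loop or
-- `bind` shifts them by one. The loop variable is `suc j`, as required for `val (suc j)`.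
controlᴮ : Builder 4
controlᴮ =
  ruleᴮ (stateᵀ ask) (readᵀ (tokᴮ true 2F (units (var 2F)))) (stateᵀ choose) ⊕ (
  ruleᴮ (stateᵀ release) (writeᵀ (tokᴮ false 2F none)) (stateᵀ ask) ⊕
  for (var 0F) (ruleᴮ (stateᵀ choose) (writeᵀ (valᴮ 3F (units (var 0F)))) (stateᵀ release)))

tokenᴮ : Bool × Bool × Bool × Bool → Builder 5
tokenᴮ (b , p , q , s) =
  ruleᴮ (stateᵀ (act b p q marked)) (readᵀ (tokᴮ s 3F (units (tl (var 0F))))) (stateᵀ (act b p q (pass (s ∨ sat b p q)))) ⊕
  ruleᴮ (stateᵀ (act b p q (pass s))) (writeᵀ (tokᴮ s 3F (units (var 0F)))) (stateᵀ (act b p q idle))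

enterᴮ : Bool → Builder 5
enterᴮ b = ruleᴮ (stateᵀ init) (readᵀ (valᴮ 3F none)) (at?ᵀ b marked 0F (var 2F))

-- Variable 0 is `suc j`: dropping its tail from the list of clauses exposes clause j, dropping the
-- whole numeral exposes the next one or the empty list.
moveᴮ : Bool → Builder 6
moveᴮ b = ruleᴮ (bind (hd (drop (tl (var 0F)) (var 3F))) (atᵀ b idle 2F 0F)) (readᵀ (valᴮ 4F (units (var 0F))))
  (at?ᵀ b marked 1F (drop (var 0F) (var 3F)))

rulesᴮ : Builder 5
rulesᴮ = each quadruples tokenᴮ ⊕ (each booleans enterᴮ ⊕ for (var 1F) (each booleans moveᴮ))

threadᵀ : ∀ {k} → State → Builder k → Term k
threadᵀ s b = cons (quoted (enc-unary 37)) (cons (stateᵀ s) (build b))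

digitsᴮ : Builder 4
digitsᴮ = units (var 2F) ⊕ for (var 0F) ((one ⊕ (one ⊕ one)) ⊕ (units (var 3F) ⊕ (units (var 3F) ⊕ units (var 3F))))

bsrᵀ : Term 4
bsrᵀ = cons
  (cons (build (valᴮ 2F (one ⊕ units (var 0F)))) (cons (build (valᴮ 2F none))
    (build (emit (threadᵀ release controlᴮ) ⊕ for (var 2F) (emit (threadᵀ init rulesᴮ))))))
  (cons
    (cons (cons (build (emit (stateᵀ release) ⊕ for (var 2F) (emit (stateᵀ end)))) (build (valᴮ 2F (units (var 0F))))) nil)
    (build digitsᴮ))

reductionᵀ : Term 1
reductionᵀ =
  bind (hd (var 0F)) (
  bind (dedupᵀ (tl (var 1F))) (
  bind (build (units (var 0F))) bsrᵀ))

enc-ℕᵇ-twos : ∀ k → enc-ℕᵇ (twos k) ≡ enc-unary k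
enc-ℕᵇ-twos zero    = refl
enc-ℕᵇ-twos (suc k) = cong (nil ∙_) (enc-ℕᵇ-twos k)

-- The term computes the encoded instance

module Encoding (φ : 3-CNF) where
  open 3-CNF φ using (clauses) renaming (variables to n)
  open Reduction φ hiding (m)

  m : ℕ
  m = length L

  enc-transition : Transition → Tree
  enc-transition (s , o , s′) = enc-Fin ⌊ s ⌋ˢ ∙ enc-Label (just ⌊ o ⌋ᵒ) ∙ enc-Fin ⌊ s′ ⌋ˢ

  ⇓-state : ∀ {k} {ρ : Vec Tree k} s → ρ ⊢ stateᵀ s ⇓ enc-Fin ⌊ s ⌋ˢ
  ⇓-state s = ⇓-quoted (enc-Fin ⌊ s ⌋ˢ)

  module _ {k} {ρ : Vec Tree k} {vn : Fin k} (n⇓ : ρ ⊢ var vn ⇓ enc-unary n) where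

    n-counts : Counts ρ (one ⊕ units (var vn)) (suc n)
    n-counts = ⊕-counts one-counts (units-counts n⇓)

    tok-counts : ∀ {y b} s → Counts ρ b (toℕ y) → Counts ρ (tokᴮ s vn b) (toℕ ⌊ tok y s ⌋ᵛ)
    tok-counts {y} false h =
      subst (Counts ρ _) (sym (trans (toℕ-↑ˡ _ (suc m)) (toℕ-↑ˡ y (suc n)))) h
    tok-counts {y} true  h =
      subst (Counts ρ _) (sym (trans (toℕ-↑ˡ _ (suc m)) (toℕ-↑ʳ (suc n) y))) (⊕-counts n-counts h)

    domain-counts : ∀ {j b} → Counts ρ b j → Counts ρ (valᴮ vn b) ((suc n + suc n) + j)
    domain-counts h = ⊕-counts (⊕-counts n-counts n-counts) h

    val-counts : ∀ {j b} → Counts ρ b (toℕ j) → Counts ρ (valᴮ vn b) (toℕ ⌊ val j ⌋ᵛ)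
    val-counts {j} h = subst (Counts ρ _) (sym (toℕ-↑ʳ (suc n + suc n) j)) (domain-counts h)

  ⇓-read : ∀ {k} {ρ : Vec Tree k} {b} v → Counts ρ b (toℕ ⌊ v ⌋ᵛ) → ρ ⊢ readᵀ b ⇓ enc-Label (just ⌊ read v ⌋ᵒ)
  ⇓-read v h = ⇓-cons (by refl) (build-counts h)

  ⇓-write : ∀ {k} {ρ : Vec Tree k} {b} v → Counts ρ b (toℕ ⌊ v ⌋ᵛ) → ρ ⊢ writeᵀ b ⇓ enc-Label (just ⌊ write v ⌋ᵒ)
  ⇓-write v h = ⇓-cons (by refl) (build-counts h)

  ⇓-rule : ∀ {k} {ρ : Vec Tree k} {e f e′} s o s′ → ρ ⊢ e ⇓ enc-Fin ⌊ s ⌋ˢ → ρ ⊢ f ⇓ enc-Label (just ⌊ o ⌋ᵒ) →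
    ρ ⊢ e′ ⇓ enc-Fin ⌊ s′ ⌋ˢ → ρ ⊢ ruleᴮ e f e′ ⇓ᴮ enc-transition (s , o , s′) ∷ []
  ⇓-rule s o s′ e⇓ f⇓ e′⇓ = ⇓-emit (⇓-cons e⇓ (⇓-cons f⇓ e′⇓))

  ⇓-select : ∀ {k} {ρ : Vec Tree (2 + k)} {vc} b φ (x : Fin n) C →
    ρ ⊢ var 1F ⇓ enc-literal (x , true) → ρ ⊢ var 0F ⇓ enc-literal (x , false) →
    ρ ⊢ var vc ⇓ enc-literals C → ρ ⊢ selectᵀ b φ vc ⇓ enc-Fin ⌊ at x b φ C ⌋ˢ
  ⇓-select {ρ = ρ} {vc} b φ x C (by x⇓) (by ¬x⇓) (by C⇓) = by selected
    where
    selected : ⟦ selectᵀ b φ vc ⟧ ρ ≡ enc-Fin ⌊ at x b φ C ⌋ˢ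
    selected
      rewrite ⟦ite⟧ (memberᵀ 1F vc)
                (ite (memberᵀ 0F vc) (stateᵀ (act b true true φ)) (stateᵀ (act b true false φ)))
                (ite (memberᵀ 0F vc) (stateᵀ (act b false true φ)) (stateᵀ (act b false false φ))) ρ
            | ⟦ite⟧ (memberᵀ 0F vc) (stateᵀ (act b true true φ)) (stateᵀ (act b true false φ)) ρ
            | ⟦ite⟧ (memberᵀ 0F vc) (stateᵀ (act b false true φ)) (stateᵀ (act b false false φ)) ρ
            | ⟦member⟧ 1F vc ρ (x , true) C x⇓ C⇓ | ⟦member⟧ 0F vc ρ (x , false) C ¬x⇓ C⇓
      with member (x , true) C | member (x , false) C
    ... | true  | true  = ⟦quoted⟧ (enc-Fin ⌊ act b true true φ ⌋ˢ) ρ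
    ... | true  | false = ⟦quoted⟧ (enc-Fin ⌊ act b true false φ ⌋ˢ) ρ
    ... | false | true  = ⟦quoted⟧ (enc-Fin ⌊ act b false true φ ⌋ˢ) ρ
    ... | false | false = ⟦quoted⟧ (enc-Fin ⌊ act b false false φ ⌋ˢ) ρ

  ⇓-at : ∀ {k} {ρ : Vec Tree k} {vx vc} b φ x C → ρ ⊢ var vx ⇓ enc-unary (suc (toℕ x)) →
    ρ ⊢ var vc ⇓ enc-literals C → ρ ⊢ atᵀ b φ vx vc ⇓ enc-Fin ⌊ at x b φ C ⌋ˢ
  ⇓-at {ρ = ρ} {vx} {vc} b φ x C (by x⇓) (by C⇓) =
    by (evaluates (⇓-select {ρ = ¬x Vec.∷ +x Vec.∷ ρ} {suc (suc vc)} b φ x C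
      (by (cong (λ t → tlᵗ t ∙ enc-Bool true) x⇓)) (by (cong (λ t → tlᵗ t ∙ enc-Bool false) x⇓)) (by C⇓)))
    where
    +x ¬x : Tree
    +x = tlᵗ (Vec.lookup ρ vx) ∙ enc-Bool true
    ¬x = tlᵗ (Vec.lookup ρ vx) ∙ enc-Bool false

  -- What is left after dropping i clauses is `nil` exactly when `clauseAt L i` is `nothing`, so
  -- testing it decides between `end` and a clause.
  ⇓-at? : ∀ {k} {ρ : Vec Tree k} {vx u} b φ x i → ρ ⊢ var vx ⇓ enc-unary (suc (toℕ x)) →
    ρ ⊢ u ⇓ dropᵗ (enc-unary (toℕ i)) (enc-clauses L) → ρ ⊢ at?ᵀ b φ vx u ⇓ enc-Fin ⌊ at? x b φ (clauseAt L i) ⌋ˢ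
  ⇓-at? {ρ = ρ} {vx} {u} b φ x i x⇓ (by u⇓) =
    by (trans (⟦ite⟧ u (bind (hd u) (atᵀ b φ (suc vx) 0F)) (stateᵀ end) ρ)
      (trans (cong continue u⇓) (go L i)))
    where
    continue : Tree → Tree
    continue t = ifᵇ truthy t then ⟦ atᵀ b φ (suc vx) 0F ⟧ (hdᵗ t Vec.∷ ρ) else ⟦ stateᵀ end ⟧ ρ
    go : ∀ L i → continue (dropᵗ (enc-unary (toℕ i)) (enc-clauses L)) ≡ enc-Fin ⌊ at? x b φ (clauseAt L i) ⌋ˢ
    go []      zero    = ⟦quoted⟧ (enc-Fin ⌊ end ⌋ˢ) ρ
    go (C ∷ L) zero    = evaluates (⇓-at {ρ = enc-literals C Vec.∷ ρ} {suc vx} {0F} b φ x C (by (evaluates x⇓)) (by refl))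
    go (C ∷ L) (suc i) = go L i

  hd-drop : ∀ L (j : Fin (length L)) → hdᵗ (dropᵗ (enc-unary (toℕ j)) (enc-clauses L)) ≡ enc-literals {n} (lookup L j)
  hd-drop (C ∷ L) zero    = refl
  hd-drop (C ∷ L) (suc j) = hd-drop L j

  module _ (I : Tree) where

    ρ₄ : Vec Tree 4
    ρ₄ = enc-unary m Vec.∷ enc-clauses L Vec.∷ enc-unary n Vec.∷ I Vec.∷ Vec.[]

    ⇓-control : ρ₄ ⊢ controlᴮ ⇓ᴮ map enc-transition (rules zero)
    ⇓-control = by (trans (evaluatesᴮ controls) (cong₂ _∷_ refl (cong₂ _∷_ refl (sym (map-tabulate choice enc-transition)))))
      where
      choice : Fin m → Transition
      choice j = choose , write (val (suc j)) , release
      controls : ρ₄ ⊢ controlᴮ ⇓ᴮ enc-transition (ask , read (tok (fromℕ n) true) , choose) ∷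
        enc-transition (release , write (tok zero false) , ask) ∷ tabulate (enc-transition ∘ choice)
      controls = ⇓-⊕
        (⇓-rule ask (read (tok (fromℕ n) true)) choose (⇓-state ask)
          (⇓-read (tok (fromℕ n) true) (tok-counts (by refl) true (units-counts (by (cong enc-unary (sym (toℕ-fromℕ n)))))))
          (⇓-state choose))
        (⇓-⊕
          (⇓-rule release (write (tok zero false)) ask (⇓-state release)
            (⇓-write (tok zero false) (tok-counts {vn = 2F} (by refl) {zero} false (by refl))) (⇓-state ask))
          (⇓-for₁ m (enc-transition ∘ choice) (by refl) λ j →
            ⇓-rule choose (write (val (suc j))) release (⇓-state choose)
              (⇓-write (val (suc j)) (val-counts (by refl) (units-counts (by refl)))) (⇓-state release)))

    module _ (x : Fin n) where

      ρ₅ : Vec Tree 5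
      ρ₅ = enc-unary (suc (toℕ x)) Vec.∷ ρ₄

      ⇓-token : ∀ bpqs → ρ₅ ⊢ tokenᴮ bpqs ⇓ᴮ map enc-transition (tokenRulesAt x bpqs)
      ⇓-token (b , p , q , s) = ⇓-⊕
        (⇓-rule (act b p q marked) (read (tok (inject₁ x) s)) (act b p q (pass (s ∨ sat b p q)))
          (⇓-state (act b p q marked))
          (⇓-read (tok (inject₁ x) s) (tok-counts (by refl) s (units-counts (by (cong enc-unary (sym (toℕ-inject₁ x)))))))
          (⇓-state (act b p q (pass (s ∨ sat b p q)))))
        (⇓-rule (act b p q (pass s)) (write (tok (suc x) s)) (act b p q idle) (⇓-state (act b p q (pass s)))
          (⇓-write (tok (suc x) s) (tok-counts (by refl) s (units-counts (by refl)))) (⇓-state (act b p q idle)))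

      ⇓-enter : ∀ b → ρ₅ ⊢ enterᴮ b ⇓ᴮ enc-transition (enterRule x b) ∷ []
      ⇓-enter b = ⇓-rule init (read (val zero)) (at? x b marked (clauseAt L zero)) (⇓-state init)
        (⇓-read (val zero) (val-counts {vn = 3F} (by refl) {zero} (by refl)))
        (⇓-at? b marked x zero (by refl) (by refl))

      ⇓-move : ∀ j b → enc-unary (suc (toℕ j)) Vec.∷ ρ₅ ⊢ moveᴮ b ⇓ᴮ enc-transition (moveRule x j b) ∷ []
      ⇓-move j b = ⇓-rule (at x b idle (lookup L j)) (read (val (suc j))) (at? x b marked (clauseAt L (suc j)))
        (by (evaluates (⇓-at {ρ = C Vec.∷ enc-unary (suc (toℕ j)) Vec.∷ ρ₅} {2F} {0F} b idle x (lookup L j) (by refl) (by (hd-drop L j)))))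
        (⇓-read (val (suc j)) (val-counts (by refl) (units-counts (by refl))))
        (⇓-at? b marked x (suc j) (by refl) (by refl))
        where
        C : Tree
        C = hdᵗ (dropᵗ (enc-unary (toℕ j)) (enc-clauses L))

      ⇓-moves : ρ₅ ⊢ for (var 1F) (each booleans moveᴮ) ⇓ᴮ map enc-transition (moveRules x)
      ⇓-moves = by (trans
        (evaluatesᴮ (⇓-for {e = var 1F} m (λ j → map enc-transition (map (moveRule x j) booleans)) (by refl)
          λ j → ⇓-each₁ enc-transition (moveRule x j) booleans (⇓-move j)))
        (trans (cong concat (sym (map-tabulate (λ j → map (moveRule x j) booleans) (map enc-transition))))
          (concat-map (tabulate λ j → map (moveRule x j) booleans))))

      ⇓-rules : ρ₅ ⊢ rulesᴮ ⇓ᴮ map enc-transition (rules (suc x))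
      ⇓-rules = by (trans
        (evaluatesᴮ (⇓-⊕ (⇓-each enc-transition (tokenRulesAt x) quadruples ⇓-token)
          (⇓-⊕ (⇓-each₁ enc-transition (enterRule x) booleans ⇓-enter) ⇓-moves)))
        (sym (trans (map-++ enc-transition (tokenRules x) (enterRules x ++ moveRules x))
          (cong (map enc-transition (tokenRules x) ++_) (map-++ enc-transition (enterRules x) (moveRules x))))))

    ⇓-thread : ∀ {k} {ρ : Vec Tree k} {b} s i → ρ ⊢ b ⇓ᴮ map enc-transition (rules i) →
      ρ ⊢ threadᵀ s b ⇓ enc-Thread (record { states = 37 ; q⁰ = ⌊ s ⌋ˢ ; δ = map ⌊_⌋ᵗ (rules i) })
    ⇓-thread s i (by h) = ⇓-cons (⇓-quoted (enc-unary 37))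
      (⇓-cons (⇓-state s) (by (cong enc-trees (trans h (map-∘ (rules i))))))

    ⇓-digits : ρ₄ ⊢ build digitsᴮ ⇓ enc-unary stageDigits
    ⇓-digits = build-counts (⊕-counts (units-counts (by refl))
      (for-unary-counts m (by refl) λ w → ⊕-counts (⊕-counts one-counts (⊕-counts one-counts one-counts))
        (⊕-counts (units-counts (by refl)) (⊕-counts (units-counts (by refl)) (units-counts (by refl))))))

    ⇓-bsr : ρ₄ ⊢ bsrᵀ ⇓ enc-BSR bsr
    ⇓-bsr = ⇓-cons
      (⇓-cons (build-counts (domain-counts (by refl) (⊕-counts one-counts (units-counts (by refl)))))
        (⇓-cons (build-counts (val-counts {vn = 2F} (by refl) {zero} (by refl)))
          (⇓-build (⇓-⊕ (⇓-emit (⇓-thread release zero ⇓-control))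
            (⇓-for₁ n _ (by refl) λ x → ⇓-emit (⇓-thread init (suc x) (⇓-rules x)))))))
      (⇓-cons
        (⇓-cons (⇓-cons
          (⇓-build (⇓-⊕ (⇓-emit (⇓-state release)) (⇓-for₁ n _ (by refl) λ x → ⇓-emit (⇓-state end))))
          (build-counts (val-counts {vn = 2F} (by refl) {fromℕ m} (units-counts (by (cong enc-unary (sym (toℕ-fromℕ m))))))))
          (by refl))
        -- The stage bound is a natural number; converting it back to binary recovers the digits of
        -- `twos`, whose encoding is a unary numeral.
        (by (trans (evaluates ⇓-digits)
          (sym (trans (cong enc-ℕᵇ (fromℕ-toℕ (twos stageDigits))) (enc-ℕᵇ-twos stageDigits))))))

  clauses-enc : tlᵗ (enc-3-CNF φ) ≡ enc-clauses cls
  clauses-enc = cong enc-trees (trans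
    (map-cong (λ C → cong enc-trees (map-cong (λ (x , b) → refl) (Vec.toList C))) clauses) (map-∘ clauses))

  ⟦reduction⟧ : ⟦ reductionᵀ ⟧ (enc-3-CNF φ Vec.∷ Vec.[]) ≡ enc-BSR bsr
  ⟦reduction⟧ = begin
    ⟦ reductionᵀ ⟧ (I Vec.∷ Vec.[])
      ≡⟨ cong (λ t → ⟦ bind (build (units (var 0F))) bsrᵀ ⟧ (t Vec.∷ enc-unary n Vec.∷ I Vec.∷ Vec.[]))
           (⟦dedup⟧ (tl (var 1F)) (enc-unary n Vec.∷ I Vec.∷ Vec.[]) cls clauses-enc) ⟩
    ⟦ bind (build (units (var 0F))) bsrᵀ ⟧ ρ₃
      ≡⟨ cong (λ t → ⟦ bsrᵀ ⟧ (t Vec.∷ ρ₃)) (evaluates (build-counts m-counts)) ⟩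
    ⟦ bsrᵀ ⟧ (ρ₄ I)
      ≡⟨ evaluates (⇓-bsr I) ⟩
    enc-BSR bsr ∎
    where
    open ≡-Reasoning
    I : Tree
    I = enc-3-CNF φ
    ρ₃ : Vec Tree 3
    ρ₃ = enc-clauses L Vec.∷ enc-unary n Vec.∷ I Vec.∷ Vec.[]
    m-counts : Counts ρ₃ (units (var 0F)) m
    m-counts = subst (Counts ρ₃ (units (var 0F))) (length-map enc-literals L) (units-length (map enc-literals L) (by refl))

-- The lower bound

foldr-⊔-const : ∀ n a → Functional.foldr _⊔_ 0 {suc n} (λ _ → a) ≡ a
foldr-⊔-const zero    a = ⊔-identityʳ a
foldr-⊔-const (suc n) a = trans (cong (a ⊔_) (foldr-⊔-const n a)) (⊔-idem a)

proposition21 : ETH →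
    ¬ SolvableInTime2^o BSR (λ I → numThreads I * ⌈log₂ maxThreadStates I ⌉)
-- With n + 1 threads of 37 states the parameter is `suc n * ⌈log₂ 37 ⌉`, and the encoding of a
-- formula, being a pair, has size at least 2.
proposition21 eth solvable = eth (solvable-via-reduction {3-SAT} {BSR} ⌈log₂ 37 ⌉ (s≤s z≤n)
  reductionᵀ Reduction.bsr (λ φ → s≤s (≤-trans (1≤size (enc-unary (3-CNF.variables φ))) (m≤m+n _ _))) Encoding.⟦reduction⟧ Reduction.correct
  (λ φ → cong (λ P → suc (3-CNF.variables φ) * ⌈log₂ P ⌉) (foldr-⊔-const (3-CNF.variables φ) 37)) solvable)
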